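{- Let $n = 2^l \cdot m$, where $l \geq 0$ is an integer and $m$ is a positive odd integer, and let $q = 2^n$. Let $C_{q^2+1}$ be the cyclic subgroup of order $q^2+1$ of $\mathbb{F}_{q^4}^*$ and let $H := C_{q^2+1} \setminus \{1\}$. Define three subsets $H_1, H_2, H_3$ of $H$ as follows. (1) $\gamma \in H$ belongs to $H_1$ if and only if $|\theta(\gamma)|$ divides $q+1$ and $|\theta^i(\gamma)|$ divides $q-1$ for all integers $i \geq 2$. (2) $\gamma \in H$ belongs to $H_2$ if and only if all of the following hold: (a) for every integer $i$ with $1 \leq i \leq l+1$ there are two integers $d_i, e_i$ greater than $1$ with $d_i \mid (q+1)$ and $e_i \mid (q-1)$ such that $|\theta^i(\gamma)| = d_i e_i$; (b) $|\theta^{l+2}(\gamma)|$ divides $q+1$; (c) $|\theta^i(\gamma)|$ divides $q-1$ for all integers $i \geq l+3$. (3) $\gamma \in H$ belongs to $H_3$ if and only if for every positive integer $i$ there are two integers $d_i, e_i$ greater than $1$ with $d_i \mid (q+1)$ and $e_i \mid (q-1)$ such that $|\theta^i(\gamma)| = d_i e_i$. Then $H = H_1 \cup H_2 \cup H_3$, and the pairwise intersections of $H_1$, $H_2$, $H_3$ are empty.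
   Context: For a finite field $F$ of characteristic $2$, the map $\theta$ on the projective line $\mathbf{P}^1(F) = F \cup \{\infty\}$ is defined by $\theta(0) = \theta(\infty) = \infty$ and $\theta(x) = x + x^{ -1}$ for $x \in F \setminus \{0\}$ (compatibly with field extensions). $\theta^i$ denotes the $i$-fold composition of $\theta$ with itself. For a nonzero field element $x$, $|x|$ denotes its multiplicative order; by convention $|0| = 1$ and $|\infty| = 1$. -}

module Defs where

open import Algebra.Bundles using (CommutativeRing)
open import Data.Fin.Base using (Fin; toℕ)
import Data.Fin.Properties as Fin
open import Data.Nat.Base using (ℕ; zero; suc; _∸_; _≤_; _<_; z≤n; s≤s; z<s)
open import Data.Nat.Divisibility using (_∣_)
open import Data.Nat.Properties using (n<1+n; m<n⇒0<n∸m; m+[n∸m]≡n; <⇒≤)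
open import Data.Product.Base using (Σ; ∃; ∃₂; _×_; _,_; proj₁; proj₂)
import Function.Endo.Propositional as Endo
open import Function.Bundles using (Inverse; Injection)
open import Function.Properties.Inverse using (Inverse⇒Injection)
open import Level using (Level; _⊔_) renaming (suc to lsuc)
open import Relation.Binary.Bundles using (Setoid)
import Relation.Binary.Construct.On as On
open import Relation.Binary.Definitions renaming (Decidable to Decidable₂)
open import Relation.Binary.PropositionalEquality as ≡ using (_≡_)
open import Relation.Nullary using (¬_; yes; no; contradiction)
open import Relation.Nullary.Decidable using (via-injection)
open import Relation.Unary using (Pred; Decidable; _∈_)

HasCardinality : ∀ {a r} → Setoid a r → ℕ → Set (a ⊔ r)
HasCardinality S N = Inverse S (≡.setoid (Fin N))

record FiniteField (c ℓ : Level) (N : ℕ) : Set (lsuc (c ⊔ ℓ)) where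
  field
    commutativeRing : CommutativeRing c ℓ

  open CommutativeRing commutativeRing public

  field
    1≉0         : ¬ (1# ≈ 0#)
    inverse     : ∀ x → ¬ (x ≈ 0#) → ∃ λ y → x * y ≈ 1#
    cardinality : HasCardinality setoid N

  open import Algebra.Properties.Semiring.Exp semiring public

  _≟_ : Decidable₂ _≈_
  _≟_ = via-injection (Inverse⇒Injection cardinality) Fin._≟_

open import Data.Nat.Base using (_+_; _*_)

least : ∀ {p} {P : Pred ℕ p} → Decidable P → ∀ k → P k →
        ∃ λ j → P j × (∀ i → P i → j ≤ i)
least P? zero    p = zero , p , λ _ _ → z≤n
least P? (suc k) p with P? zero
... | yes p₀ = zero , p₀ , λ _ _ → z≤n
... | no ¬p₀ with least (λ i → P? (suc i)) k p
...   | j , pⱼ , min = suc j , pⱼ , λ where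
          zero    p₀ → contradiction p₀ ¬p₀
          (suc i) pᵢ → s≤s (min i pᵢ)

module _ {c ℓ : Level} {N : ℕ} (F : FiniteField c ℓ N) where

  open FiniteField F using (Carrier; _≈_; 0#; 1#; _^_; setoid; inverse; cardinality; _≟_)
  private module F = FiniteField F

  IsOrder : Carrier → ℕ → Set ℓ
  IsOrder x k = 0 < k × x ^ k ≈ 1# × (∀ j → 0 < j → x ^ j ≈ 1# → k ≤ j)

  private
    cancel : ∀ {x a b} → ¬ (x ≈ 0#) → x F.* a ≈ x F.* b → a ≈ b
    cancel {x} {a} {b} x≉0 xa≈xb = begin
      a                ≈⟨ expand a ⟨
      y F.* (x F.* a)  ≈⟨ F.*-congˡ xa≈xb ⟩
      y F.* (x F.* b)  ≈⟨ expand b ⟩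
      b                ∎
      where
      open import Relation.Binary.Reasoning.Setoid setoid
      y = proj₁ (inverse x x≉0)
      expand : ∀ z → y F.* (x F.* z) ≈ z
      expand z = begin
        y F.* (x F.* z)  ≈⟨ F.*-assoc y x z ⟨
        y F.* x F.* z    ≈⟨ F.*-congʳ (F.*-comm y x) ⟩
        x F.* y F.* z    ≈⟨ F.*-congʳ (proj₂ (inverse x x≉0)) ⟩
        1# F.* z         ≈⟨ F.*-identityˡ z ⟩
        z                ∎

    cancel-^ : ∀ {x} → ¬ (x ≈ 0#) → ∀ i k → x ^ i ≈ x ^ (i + k) → x ^ k ≈ 1#
    cancel-^ x≉0 zero    k eq = F.sym eq
    cancel-^ x≉0 (suc i) k eq = cancel-^ x≉0 i k (cancel x≉0 eq)

    torsion : ∀ x → ¬ (x ≈ 0#) → ∃ λ k → x ^ suc k ≈ 1#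
    torsion x x≉0 with Fin.pigeonhole (n<1+n N) (λ i → Inverse.to cardinality (x ^ toℕ i))
    ... | i , j , i<j , eq = pos (toℕ j ∸ toℕ i) (m<n⇒0<n∸m i<j)
          (cancel-^ x≉0 (toℕ i) (toℕ j ∸ toℕ i)
            (F.trans (Injection.injective (Inverse⇒Injection cardinality) eq)
                     (F.^-congʳ x (≡.sym (m+[n∸m]≡n (<⇒≤ i<j))))))
      where
      pos : ∀ k → 0 < k → x ^ k ≈ 1# → ∃ λ k → x ^ suc k ≈ 1#
      pos (suc k) _ eq = k , eq

  orderOfNonzero : ∀ x → ¬ (x ≈ 0#) → ∃ (IsOrder x)
  orderOfNonzero x x≉0
    with k , eq ← torsion x x≉0
    with j , xʲ , min ← least (λ i → (x ^ suc i) ≟ 1#) k eq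
    = suc j , z<s , xʲ , λ where (suc i) _ xⁱ → s≤s (min i xⁱ)

  data P¹ : Set c where
    fin : Carrier → P¹
    ∞   : P¹

  ord : P¹ → ℕ
  ord ∞ = 1
  ord (fin x) with x ≟ 0#
  ... | yes _   = 1
  ... | no  x≉0 = proj₁ (orderOfNonzero x x≉0)

  θ : P¹ → P¹
  θ ∞ = ∞
  θ (fin x) with x ≟ 0#
  ... | yes _   = ∞
  ... | no  x≉0 = fin (x F.+ proj₁ (inverse x x≉0))

  θ^ : ℕ → P¹ → P¹
  θ^ i = θ ⟨^⟩ i
    where open Endo P¹ renaming (_^_ to _⟨^⟩_)

  -- Natural-number exponents suffice: a nonzero g has finite order, so its
  -- inverse is one of its positive powers.
  ⟨_⟩ : Carrier → Pred Carrier ℓ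
  ⟨ g ⟩ x = ∃ λ k → x ≈ g ^ k

  record CyclicSubgroup (M : ℕ) : Set (c ⊔ ℓ) where
    field
      generator   : Carrier
      generator≉0 : ¬ (generator ≈ 0#)
      size        : HasCardinality (On.setoid {B = Σ Carrier ⟨ generator ⟩} setoid proj₁) M

    Member : Pred Carrier ℓ
    Member = ⟨ generator ⟩

  HasMixedOrder : ℕ → P¹ → Set
  HasMixedOrder q x = ∃₂ λ d e → 1 < d × 1 < e × d ∣ (q + 1) × e ∣ (q ∸ 1) × ord x ≡ d * e

  module _ {M : ℕ} (C : CyclicSubgroup M) where

    H : Pred Carrier ℓ
    H γ = γ ∈ CyclicSubgroup.Member C × ¬ (γ ≈ 1#)

    H₁ : (q : ℕ) → Pred Carrier ℓ
    H₁ q γ = γ ∈ H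
           × ord (θ (fin γ)) ∣ (q + 1)
           × (∀ i → 2 ≤ i → ord (θ^ i (fin γ)) ∣ (q ∸ 1))

    H₂ : (q l : ℕ) → Pred Carrier ℓ
    H₂ q l γ = γ ∈ H
             × (∀ i → 1 ≤ i → i ≤ l + 1 → HasMixedOrder q (θ^ i (fin γ)))
             × ord (θ^ (l + 2) (fin γ)) ∣ (q + 1)
             × (∀ i → l + 3 ≤ i → ord (θ^ i (fin γ)) ∣ (q ∸ 1))

    H₃ : (q : ℕ) → Pred Carrier ℓ
    H₃ q γ = γ ∈ H × (∀ i → 1 ≤ i → HasMixedOrder q (θ^ i (fin γ)))

{-# OPTIONS --safe #-}
module Submission where

-- Let σ be the q-power Frobenius map. An element of F_{q²} has mixed order exactly
-- when it is neither fixed nor inverted by σ; θ γ lies in F_{q²} and is not fixed,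
-- and the first non-mixed θⁱ γ is inverted, so that all later iterates lie in F_q.
-- It remains to show that the first non-mixed index i ≥ 2 can only be l + 2.
--
-- On x-coordinates of the curve y² + xy = x³ + 1, θ is the dual of the Frobenius
-- isogeny, and inversion x ↦ 1/x is translation by the point (0 , 1). The polynomial
-- G x y z vanishes when x, y, z are the x-coordinates of three points with sum zero;
-- only identities for G are needed, not the group law. If θⁱ γ is inverted by σ then
-- G (z , σ z , r) = 0 for z = θⁱ⁻¹ γ and r = 1, and G lifts along θ. Hence
-- G (z , σ z , r) = 0 for z = θⁱ⁻¹⁻ˢ γ and some r with θˢ r = 1. Such an r has degree
-- 2ˢ over F₂ : it is fixed by σ for s ≤ l and inverted by σ for s = l + 1. As
-- G (x , y , z) and G (1/x , y , z) vanish together only if 1 ∈ {x , y , z}, applying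
-- σ gives a contradiction for i < l + 2 (at z = γ) and for i > l + 2 (at s = l + 1).

open import Defs
import Algebra.Properties.CommutativeMonoid.Sum
open import Algebra.Bundles using (CommutativeMonoid; CommutativeRing)
open import Algebra.Solver.Ring.AlmostCommutativeRing using (fromCommutativeSemiring; _-Raw-AlmostCommutative⟶_; Induced-equivalence)
open import Data.Bool.Base using (true; false)
open import Data.Bool.Properties using (xor-∧-commutativeRing)
open import Data.Maybe.Base using (just; nothing)
import Data.Fin.Base
import Data.Nat.Base as ℕ
open import Data.Nat.Base using (ℕ; suc)
open import Data.Nat.DivMod using (_/_; _%_; m%n<n; m≡m%n+[m/n]*n)
open import Data.Nat.Divisibility using (_∣_; _∤_; divides; m%n≡0⇒n∣m; n∣m*n; m∣m*n; *-cancelʳ-∣; ∣m+n∣m⇒∣n; ∣⇒≤; ∣1⇒≡1; 1∣_; ∣-trans)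
open import Data.Nat.GCD using (gcd; gcd[m,n]∣m; gcd[m,n]∣n; gcd-greatest; c*gcd[m,n]≡gcd[cm,cn])
import Data.Nat.Properties as ℕ
open import Data.Product.Base using (∃; ∃₂; _×_; _,_; proj₁; proj₂)
open import Data.Sum.Base using (_⊎_; inj₁; inj₂; [_,_]′)
open import Data.Unit.Polymorphic.Base using (⊤; tt)
open import Function.Base using (_∘_)
open import Function.Bundles using (Inverse; mk↔ₛ′)
open import Level using (Level)
open import Relation.Binary.Bundles using (Setoid)
open import Relation.Binary.Definitions using (WeaklyDecidable)
open import Relation.Binary.PropositionalEquality as ≡ using (_≡_)
open import Relation.Nullary using (¬_; yes; no; contradiction)
open import Relation.Nullary.Decidable using (toSum)
open import Relation.Unary using (Pred)

-- Factorisations and divisors of natural numbers.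

2^l*m-factor : ∀ {s l} m → s ℕ.≤ l → 2 ℕ.^ l ℕ.* m ≡ m ℕ.* 2 ℕ.^ (l ℕ.∸ s) ℕ.* 2 ℕ.^ s
2^l*m-factor {s} {l} m s≤l = begin
  2 ℕ.^ l ℕ.* m                          ≡⟨ ℕ.*-comm (2 ℕ.^ l) m ⟩
  m ℕ.* 2 ℕ.^ l                          ≡⟨ ≡.cong (λ i → m ℕ.* 2 ℕ.^ i) (ℕ.m∸n+n≡m s≤l) ⟨
  m ℕ.* 2 ℕ.^ (l ℕ.∸ s ℕ.+ s)            ≡⟨ ≡.cong (m ℕ.*_) (ℕ.^-distribˡ-+-* 2 (l ℕ.∸ s) s) ⟩
  m ℕ.* (2 ℕ.^ (l ℕ.∸ s) ℕ.* 2 ℕ.^ s)    ≡⟨ ℕ.*-assoc m _ _ ⟨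
  m ℕ.* 2 ℕ.^ (l ℕ.∸ s) ℕ.* 2 ℕ.^ s      ∎
  where open ≡.≡-Reasoning

odd-decomposition : ∀ {m} → 2 ∤ m → m ≡ suc (m / 2 ℕ.* 2)
odd-decomposition {m} 2∤m with m % 2 in m%2≡ | m%n<n m 2 | m≡m%n+[m/n]*n m 2
... | 0           | _                  | _  = contradiction (m%n≡0⇒n∣m m 2 m%2≡) 2∤m
... | 1           | _                  | eq = eq
... | suc (suc _) | ℕ.s≤s (ℕ.s≤s ()) | _

-- Take `d = gcd o a` and `e = o / d`. As `o` divides both `b * o` and `b * a`, it divides `b * d`,
-- so `e ∣ b`. If `d` were 1 then `o = e` would divide `b`, and if `e` were 1 then `o = d` would
-- divide `a`.
divisor-split : ∀ {o a b} → 0 ℕ.< o → o ∣ a ℕ.* b → o ∤ a → o ∤ b →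
                ∃₂ λ d e → 1 ℕ.< d × 1 ℕ.< e × d ∣ a × e ∣ b × o ≡ d ℕ.* e
divisor-split {o} {a} {b} 0<o o∣ab o∤a o∤b with divides e o≡e*d ← gcd[m,n]∣m o a =
  d , e , above-one d≢0 d≢1 , above-one e≢0 e≢1 , gcd[m,n]∣n o a , e∣b , o≡d*e
  where
  d = gcd o a
  o≡d*e : o ≡ d ℕ.* e
  o≡d*e = ≡.trans o≡e*d (ℕ.*-comm e d)
  d≢0 : ¬ (d ≡ 0)
  d≢0 d≡0 = ℕ.<⇒≢ 0<o (≡.sym (≡.trans o≡d*e (≡.cong (ℕ._* e) d≡0)))
  e≢0 : ¬ (e ≡ 0)
  e≢0 e≡0 = ℕ.<⇒≢ 0<o (≡.sym (≡.trans o≡e*d (≡.cong (ℕ._* d) e≡0)))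
  e∣b : e ∣ b
  e∣b = *-cancelʳ-∣ d {{ℕ.≢-nonZero d≢0}} (≡.subst₂ _∣_ o≡e*d (≡.sym (c*gcd[m,n]≡gcd[cm,cn] b o a))
          (gcd-greatest (n∣m*n b) (≡.subst (o ∣_) (ℕ.*-comm a b) o∣ab)))
  d≢1 : ¬ (d ≡ 1)
  d≢1 d≡1 = o∤b (≡.subst (_∣ b) (≡.sym (≡.trans o≡d*e (≡.trans (≡.cong (ℕ._* e) d≡1) (ℕ.*-identityˡ e)))) e∣b)
  e≢1 : ¬ (e ≡ 1)
  e≢1 e≡1 = o∤a (≡.subst (_∣ a) (≡.sym (≡.trans o≡e*d (≡.trans (≡.cong (ℕ._* d) e≡1) (ℕ.*-identityˡ d)))) (gcd[m,n]∣n o a))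
  above-one : ∀ {k} → ¬ (k ≡ 0) → ¬ (k ≡ 1) → 1 ℕ.< k
  above-one {0}           k≢0 _   = contradiction ≡.refl k≢0
  above-one {1}           _   k≢1 = contradiction ≡.refl k≢1
  above-one {suc (suc _)} _   _   = ℕ.s≤s (ℕ.s≤s ℕ.z≤n)

-- A common divisor of `q + 1` and `q - 1` divides 2, while both numbers are odd.
even⇒neighbours-coprime : ∀ {q e} → 0 ℕ.< q → 2 ∣ q → e ∣ q ℕ.+ 1 → e ∣ q ℕ.∸ 1 → ¬ (1 ℕ.< e)
even⇒neighbours-coprime {suc q} {e} _ 2∣1+q e∣2+q e∣q 1<e = contradiction (∣1⇒≡1 2∣1) λ ()
  where
  e∣2 : e ∣ 2
  e∣2 = ∣m+n∣m⇒∣n (≡.subst (e ∣_) (≡.sym (ℕ.+-suc q 1)) e∣2+q) e∣q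
  e≡2 : e ≡ 2
  e≡2 = ℕ.≤-antisym (∣⇒≤ e∣2) 1<e
  2∣1 : 2 ∣ 1
  2∣1 = ∣m+n∣m⇒∣n (≡.subst (2 ∣_) (ℕ.+-comm 1 q) 2∣1+q) (≡.subst (_∣ q) e≡2 e∣q)

-- Sums over a finite set under translation.

module _ {a b m ℓ} (M : CommutativeMonoid m ℓ) {S : Setoid a b} where
  private
    module M = CommutativeMonoid M
    module S = Setoid S
  open import Algebra.Properties.CommutativeMonoid.Sum M
  open import Algebra.Properties.Monoid.Mult M.monoid renaming (_×_ to _·_)

  -- Reindexing the sum over S along the bijection f, as in the proof of
  -- Lagrange's theorem for abelian groups.
  sum-translate : ∀ {N} (card : HasCardinality S N) (f : Inverse S S) x
                  (val : S.Carrier → M.Carrier) →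
                  (∀ {s t} → s S.≈ t → val s M.≈ val t) →
                  (∀ s → val (Inverse.to f s) M.≈ x M.∙ val s) →
                  sum (val ∘ Inverse.from card) M.≈ (N · x) M.∙ sum (val ∘ Inverse.from card)
  sum-translate {N} card f x val val-cong shift = begin
    sum v                           ≈⟨ sum-permute v π ⟩
    sum (λ i → v (Inverse.to π i))  ≈⟨ sum-cong-≋ (λ i → M.trans (val-cong (S-from (Inverse.to f (from i)))) (shift (from i))) ⟩
    sum (λ i → x M.∙ v i)           ≈⟨ ∑-distrib-+ (λ _ → x) v ⟩
    sum {N} (λ _ → x) M.∙ sum v     ≈⟨ M.∙-congʳ (sum-replicate N) ⟩
    (N · x) M.∙ sum v               ∎
    where
    open import Relation.Binary.Reasoning.Setoid M.setoid
    open Inverse card using (to; from; strictlyInverseˡ; strictlyInverseʳ; to-cong)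
    v = val ∘ from
    S-from : ∀ s → from (to s) S.≈ s
    S-from = strictlyInverseʳ
    module f = Inverse f
    π = mk↔ₛ′ (to ∘ f.to ∘ from) (to ∘ f.from ∘ from)
          (λ i → ≡.trans (to-cong (S.trans (f.to-cong (S-from _)) (f.strictlyInverseˡ _))) (strictlyInverseˡ i))
          (λ i → ≡.trans (to-cong (S.trans (f.from-cong (S-from _)) (f.strictlyInverseʳ _))) (strictlyInverseˡ i))

-- Inverses, orders and the characteristic of a finite field.

module FieldProperties {c ℓ : Level} {N : ℕ} (F : FiniteField c ℓ N) where
  open FiniteField F hiding (zero)
  open import Relation.Binary.Reasoning.Setoid setoid
  open import Algebra.Properties.Semiring.Mult semiring using (×1-homo-*; ×-congˡ) renaming (_×_ to _·_)
  open import Algebra.Properties.AbelianGroup +-abelianGroup using (identityˡ-unique)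
  module Prod = Algebra.Properties.CommutativeMonoid.Sum *-commutativeMonoid

  *-cancelˡ : ∀ {x a b} → ¬ (x ≈ 0#) → x * a ≈ x * b → a ≈ b
  *-cancelˡ {x} {a} {b} x≉0 xa≈xb = begin
    a            ≈⟨ expand a ⟨
    y * (x * a)  ≈⟨ *-congˡ xa≈xb ⟩
    y * (x * b)  ≈⟨ expand b ⟩
    b            ∎
    where
    y = proj₁ (inverse x x≉0)
    expand : ∀ z → y * (x * z) ≈ z
    expand z = begin
      y * (x * z)  ≈⟨ *-assoc y x z ⟨
      y * x * z    ≈⟨ *-congʳ (trans (*-comm y x) (proj₂ (inverse x x≉0))) ⟩
      1# * z       ≈⟨ *-identityˡ z ⟩
      z            ∎

  integral : ∀ {x y} → x * y ≈ 0# → x ≈ 0# ⊎ y ≈ 0#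
  integral {x} {y} xy≈0 with x ≟ 0#
  ... | yes x≈0 = inj₁ x≈0
  ... | no  x≉0 = inj₂ (*-cancelˡ x≉0 (trans xy≈0 (sym (zeroʳ x))))

  *-nonzero : ∀ {x y} → ¬ (x ≈ 0#) → ¬ (y ≈ 0#) → ¬ (x * y ≈ 0#)
  *-nonzero x≉0 y≉0 xy≈0 = [ x≉0 , y≉0 ]′ (integral xy≈0)

  ^-nonzero : ∀ {x} → ¬ (x ≈ 0#) → ∀ k → ¬ (x ^ k ≈ 0#)
  ^-nonzero x≉0 ℕ.zero  = 1≉0
  ^-nonzero x≉0 (suc k) = *-nonzero x≉0 (^-nonzero x≉0 k)

  ^-oneˡ : ∀ k → 1# ^ k ≈ 1#
  ^-oneˡ ℕ.zero  = refl
  ^-oneˡ (suc k) = trans (*-identityˡ _) (^-oneˡ k)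

  unit-nonzero : ∀ {x y} → x * y ≈ 1# → ¬ (x ≈ 0#)
  unit-nonzero xy≈1 x≈0 = 1≉0 (trans (sym xy≈1) (trans (*-congʳ x≈0) (zeroˡ _)))

  inverse-unique : ∀ {x y z} → x * y ≈ 1# → x * z ≈ 1# → y ≈ z
  inverse-unique xy≈1 xz≈1 = *-cancelˡ (unit-nonzero xy≈1) (trans xy≈1 (sym xz≈1))

  infix 8 _⁻¹
  -- Branching on `x ≟ 0#` as `θ` does, and taking the same inverse, makes `θ-fin` a propositional
  -- equality.
  _⁻¹ : Carrier → Carrier
  x ⁻¹ with x ≟ 0#
  ... | yes _   = 0#
  ... | no  x≉0 = proj₁ (inverse x x≉0)

  ⁻¹-inverseʳ : ∀ {x} → ¬ (x ≈ 0#) → x * x ⁻¹ ≈ 1#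
  ⁻¹-inverseʳ {x} x≉0 with x ≟ 0#
  ... | yes x≈0 = contradiction x≈0 x≉0
  ... | no  x≉0 = proj₂ (inverse x x≉0)

  θ-fin : ∀ {x} → ¬ (x ≈ 0#) → θ F (fin x) ≡ fin (x + x ⁻¹)
  θ-fin {x} x≉0 with x ≟ 0#
  ... | yes x≈0 = contradiction x≈0 x≉0
  ... | no  x≉0 = ≡.refl

  θ-zero : ∀ {x} → x ≈ 0# → θ F (fin x) ≡ ∞
  θ-zero {x} x≈0 with x ≟ 0#
  ... | yes _   = ≡.refl
  ... | no  x≉0 = contradiction x≈0 x≉0

  -- A nonzero remainder of `j` modulo `k` would be a smaller exponent that kills `x`.
  IsOrder⇒∣ : ∀ {x k} → IsOrder F x k → ∀ j → x ^ j ≈ 1# → k ∣ j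
  IsOrder⇒∣ {x} {suc k} (_ , xᵏ≈1 , minimal) j xʲ≈1 with j % suc k in j%k≡
  ... | 0     = m%n≡0⇒n∣m j (suc k) j%k≡
  ... | suc r = contradiction (minimal (suc r) ℕ.z<s xʳ≈1)
                  (ℕ.<⇒≱ (≡.subst (ℕ._< suc k) j%k≡ (m%n<n j (suc k))))
    where
    t = j / suc k
    xʳ≈1 : x ^ suc r ≈ 1#
    xʳ≈1 = begin
      x ^ suc r                          ≈⟨ *-identityʳ _ ⟨
      x ^ suc r * 1#                     ≈⟨ *-congˡ (trans (^-congˡ t xᵏ≈1) (^-oneˡ t)) ⟨
      x ^ suc r * (x ^ suc k) ^ t        ≈⟨ *-congˡ (trans (^-assocʳ x (suc k) t) (^-congʳ x (ℕ.*-comm (suc k) t))) ⟩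
      x ^ suc r * x ^ (t ℕ.* suc k)      ≈⟨ ^-homo-* x (suc r) (t ℕ.* suc k) ⟨
      x ^ (suc r ℕ.+ t ℕ.* suc k)        ≈⟨ ^-congʳ x (≡.trans (m≡m%n+[m/n]*n j (suc k)) (≡.cong (ℕ._+ t ℕ.* suc k) j%k≡)) ⟨
      x ^ j                              ≈⟨ xʲ≈1 ⟩
      1#                                 ∎

  ord-isOrder : ∀ {x} → ¬ (x ≈ 0#) → IsOrder F x (ord F (fin x))
  ord-isOrder {x} x≉0 with x ≟ 0#
  ... | yes x≈0 = contradiction x≈0 x≉0
  ... | no  x≉0 = proj₂ (orderOfNonzero F x x≉0)

  ord-zero : ∀ {x} → x ≈ 0# → ord F (fin x) ≡ 1
  ord-zero {x} x≈0 with x ≟ 0#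
  ... | yes _   = ≡.refl
  ... | no  x≉0 = contradiction x≈0 x≉0

  ord∣⇒^≈1 : ∀ {x k} → ¬ (x ≈ 0#) → ord F (fin x) ∣ k → x ^ k ≈ 1#
  ord∣⇒^≈1 {x} {k} x≉0 (divides t k≡t*o) = begin
    x ^ k                      ≈⟨ ^-congʳ x (≡.trans k≡t*o (ℕ.*-comm t o)) ⟩
    x ^ (o ℕ.* t)              ≈⟨ ^-assocʳ x o t ⟨
    (x ^ o) ^ t                ≈⟨ ^-congˡ t (proj₁ (proj₂ (ord-isOrder x≉0))) ⟩
    1# ^ t                     ≈⟨ ^-oneˡ t ⟩
    1#                         ∎
    where o = ord F (fin x)

  -- Translation by 1 permutes the field, so the sum of all elements absorbs `N` extra ones.
  cardinality·1≈0 : N · 1# ≈ 0#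
  cardinality·1≈0 = identityˡ-unique _ _ (sym
    (sum-translate +-commutativeMonoid cardinality shift 1# (λ x → x) (λ x≈y → x≈y) (λ _ → refl)))
    where
    cancel : ∀ {x y} → x + y ≈ 0# → ∀ z → x + (y + z) ≈ z
    cancel x+y≈0 z = trans (sym (+-assoc _ _ z)) (trans (+-congʳ x+y≈0) (+-identityˡ z))
    shift : Inverse setoid setoid
    shift = record
      { to = 1# +_ ; from = - 1# +_ ; to-cong = +-congˡ ; from-cong = +-congˡ
      ; inverse = (λ eq → trans (+-congˡ eq) (cancel (-‿inverseʳ 1#) _))
                , (λ eq → trans (+-congˡ eq) (cancel (-‿inverseˡ 1#) _)) }

  -- Since `N · 1# = (1 + 1) ^ k` vanishes and there are no zero divisors, `1 + 1` vanishes.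
  characteristic-2 : ∀ k → N ≡ 2 ℕ.^ k → 1# + 1# ≈ 0#
  characteristic-2 k N≡2^k = root k (trans (sym (2^· k)) (trans (×-congˡ (≡.sym N≡2^k)) cardinality·1≈0))
    where
    2^· : ∀ k → (2 ℕ.^ k) · 1# ≈ (1# + 1#) ^ k
    2^· ℕ.zero  = +-identityʳ 1#
    2^· (suc k) = trans (×1-homo-* 2 (2 ℕ.^ k)) (*-cong (+-congˡ (+-identityʳ 1#)) (2^· k))
    root : ∀ k {x} → x ^ k ≈ 0# → x ≈ 0#
    root ℕ.zero  1≈0   = contradiction 1≈0 1≉0
    root (suc k) xᵏ⁺¹≈0 = [ (λ x≈0 → x≈0) , root k ]′ (integral xᵏ⁺¹≈0)

  -- The exponent of a cyclic subgroup.

  module _ {M : ℕ} (C : CyclicSubgroup F M) where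
    open CyclicSubgroup C renaming (generator to g; generator≉0 to g≉0)

    -- Multiplication by `g` permutes the subgroup, so the nonzero product `P` of its members equals
    -- `g ^ M * P`.
    generator^size : g ^ M ≈ 1#
    generator^size = sym (*-cancelˡ P≉0 (begin
      P * 1#       ≈⟨ *-identityʳ P ⟩
      P            ≈⟨ sum-translate *-commutativeMonoid size shift g proj₁ (λ x≈y → x≈y) (λ _ → refl) ⟩
      g ^ M * P    ≈⟨ *-comm _ _ ⟩
      P * g ^ M    ∎))
      where
      P = Prod.sum (proj₁ ∘ Inverse.from size)
      product-nonzero : ∀ k v → (∀ i → ¬ (v i ≈ 0#)) → ¬ (Prod.sum {k} v ≈ 0#)
      product-nonzero ℕ.zero  v v≉0 = 1≉0
      product-nonzero (suc k) v v≉0 = *-nonzero (v≉0 _) (product-nonzero k _ (v≉0 ∘ Data.Fin.Base.suc))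
      P≉0 : ¬ (P ≈ 0#)
      P≉0 = product-nonzero M _ λ i x≈0 → let (_ , k , x≈gᵏ) = Inverse.from size i in
              ^-nonzero g≉0 k (trans (sym x≈gᵏ) x≈0)
      order : ∃ λ k → g ^ suc k ≈ 1#
      order with orderOfNonzero F g g≉0
      ... | suc k , _ , gᵏ⁺¹≈1 , _ = k , gᵏ⁺¹≈1
      k = proj₁ order
      cancel : ∀ {x y} → x * y ≈ 1# → ∀ z → x * (y * z) ≈ z
      cancel xy≈1 z = trans (sym (*-assoc _ _ z)) (trans (*-congʳ xy≈1) (*-identityˡ z))
      shift : Inverse _ _
      shift = record
        { to        = λ (x , i , x≈gⁱ) → g * x , suc i , *-congˡ x≈gⁱ
        -- `g ^ k` is the inverse of `g`, because `g ^ suc k` is 1; exponents thus stay natural.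
        ; from      = λ (x , i , x≈gⁱ) → g ^ k * x , k ℕ.+ i , trans (*-congˡ x≈gⁱ) (sym (^-homo-* g k i))
        ; to-cong   = *-congˡ
        ; from-cong = *-congˡ
        ; inverse   = (λ eq → trans (*-congˡ eq) (cancel (proj₂ order) _))
                    , (λ eq → trans (*-congˡ eq) (cancel (trans (*-comm _ g) (proj₂ order)) _)) }

    member^size : ∀ {x} → CyclicSubgroup.Member C x → x ^ M ≈ 1#
    member^size {x} (k , x≈gᵏ) = begin
      x ^ M            ≈⟨ ^-congˡ M x≈gᵏ ⟩
      (g ^ k) ^ M      ≈⟨ ^-assocʳ g k M ⟩
      g ^ (k ℕ.* M)    ≈⟨ ^-congʳ g (ℕ.*-comm k M) ⟩
      g ^ (M ℕ.* k)    ≈⟨ ^-assocʳ g M k ⟨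
      (g ^ M) ^ k      ≈⟨ ^-congˡ k generator^size ⟩
      1# ^ k           ≈⟨ ^-oneˡ k ⟩
      1#               ∎

-- Polynomial identities in characteristic two.

module CharacteristicTwo {c ℓ : Level} {N : ℕ} (F : FiniteField c ℓ N)
  (1+1≈0 : FiniteField._≈_ F (FiniteField._+_ F (FiniteField.1# F) (FiniteField.1# F)) (FiniteField.0# F)) where
  open FiniteField F hiding (zero)
  open FieldProperties F
  open import Relation.Binary.Reasoning.Setoid setoid

  private
    -- Coefficients in F₂, with xor as addition, let the ring solver cancel equal terms.
    Bool⟶F : CommutativeRing.rawRing xor-∧-commutativeRing -Raw-AlmostCommutative⟶ fromCommutativeSemiring commutativeSemiring
    Bool⟶F = record
      { ⟦_⟧    = λ where true → 1#
                         false → 0#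
      ; +-homo = λ where true true → sym 1+1≈0
                         true false → sym (+-identityʳ 1#)
                         false true → sym (+-identityˡ 1#)
                         false false → sym (+-identityʳ 0#)
      ; *-homo = λ where true true → sym (*-identityʳ 1#)
                         true false → sym (zeroʳ 1#)
                         false true → sym (zeroˡ 1#)
                         false false → sym (zeroʳ 0#)
      ; -‿homo = λ _ → refl
      ; 0-homo = refl
      ; 1-homo = refl
      }

    _≟Bool_ : WeaklyDecidable (Induced-equivalence Bool⟶F)
    true  ≟Bool true  = just refl
    false ≟Bool false = just refl
    _     ≟Bool _     = nothing

  open import Algebra.Solver.Ring (CommutativeRing.rawRing xor-∧-commutativeRing)
    (fromCommutativeSemiring commutativeSemiring) Bool⟶F _≟Bool_
    using (solve; Polynomial; con; _:+_; _:*_; _:=_)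

  :1 : ∀ {k} → Polynomial k
  :1 = con true

  :0 : ∀ {k} → Polynomial k
  :0 = con false

  x+x≈0 : ∀ x → x + x ≈ 0#
  x+x≈0 = solve 1 (λ x → x :+ x := :0) refl

  +≈0⇒≈ : ∀ {x y} → x + y ≈ 0# → x ≈ y
  +≈0⇒≈ {x} {y} x+y≈0 = begin
    x            ≈⟨ solve 2 (λ x y → x := (x :+ y) :+ y) refl x y ⟩
    (x + y) + y  ≈⟨ +-congʳ x+y≈0 ⟩
    0# + y       ≈⟨ +-identityˡ y ⟩
    y            ∎

  ≈⇒+≈0 : ∀ {x y} → x ≈ y → x + y ≈ 0#
  ≈⇒+≈0 x≈y = trans (+-congʳ x≈y) (x+x≈0 _)

  -- Certificates: an equation follows from known ones once `a + b` is written as a combination of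
  -- their differences, and this last identity is left to the solver.
  from₁ : ∀ {a b u v} k → u ≈ v → a + b ≈ k * (u + v) → a ≈ b
  from₁ k u≈v a+b≈ = +≈0⇒≈ (trans a+b≈ (trans (*-congˡ (≈⇒+≈0 u≈v)) (zeroʳ k)))

  from₂ : ∀ {a b u v u′ v′} k → u ≈ v → ∀ k′ → u′ ≈ v′ →
          a + b ≈ k * (u + v) + k′ * (u′ + v′) → a ≈ b
  from₂ k u≈v k′ u′≈v′ a+b≈ = from₁ k u≈v (trans a+b≈ (trans (+-congˡ
    (trans (*-congˡ (≈⇒+≈0 u′≈v′)) (zeroʳ k′))) (+-identityʳ _)))

  from₃ : ∀ {a b u v u′ v′ u″ v″} k → u ≈ v → ∀ k′ → u′ ≈ v′ → ∀ k″ → u″ ≈ v″ →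
          a + b ≈ k * (u + v) + k′ * (u′ + v′) + k″ * (u″ + v″) → a ≈ b
  from₃ k u≈v k′ u′≈v′ k″ u″≈v″ a+b≈ = from₂ k u≈v k′ u′≈v′ (trans a+b≈ (trans (+-congˡ
    (trans (*-congˡ (≈⇒+≈0 u″≈v″)) (zeroʳ k″))) (+-identityʳ _)))

  square≈0 : ∀ {x} → x * x ≈ 0# → x ≈ 0#
  square≈0 xx≈0 = [ (λ x≈0 → x≈0) , (λ x≈0 → x≈0) ]′ (integral xx≈0)

  square≈1 : ∀ {x} → x * x ≈ 1# → x ≈ 1#
  square≈1 {x} xx≈1 = +≈0⇒≈ (square≈0 (from₁ 1# xx≈1
    (solve 1 (λ x → (x :+ :1) :* (x :+ :1) :+ :0 := :1 :* (x :* x :+ :1)) refl x)))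

  -- Clearing denominators in the difference of the two sums gives the product
  -- `(y + x) * (y * x + 1)`.
  sum-of-inverses-injective : ∀ {x x̄ y ȳ} → x * x̄ ≈ 1# → y * ȳ ≈ 1# → y + ȳ ≈ x + x̄ → y ≈ x ⊎ y * x ≈ 1#
  sum-of-inverses-injective {x} {x̄} {y} {ȳ} xx̄≈1 yȳ≈1 eq =
    [ inj₁ ∘ +≈0⇒≈ , inj₂ ∘ +≈0⇒≈ ]′ (integral (from₃ (x * y) eq x yȳ≈1 y xx̄≈1
      (solve 4 (λ x x̄ y ȳ → (y :+ x) :* (y :* x :+ :1) :+ :0
          := x :* y :* (y :+ ȳ :+ (x :+ x̄)) :+ x :* (y :* ȳ :+ :1) :+ y :* (x :* x̄ :+ :1)) refl x x̄ y ȳ)))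

  clear-denominator : ∀ {x x̄} → x * x̄ ≈ 1# → (x + x̄) * x ≈ x * x + 1#
  clear-denominator {x} {x̄} xx̄≈1 = from₁ 1# xx̄≈1
    (solve 2 (λ x x̄ → (x :+ x̄) :* x :+ (x :* x :+ :1) := :1 :* (x :* x̄ :+ :1)) refl x x̄)

  -- Powers of the squaring Frobenius map.

  φ : ℕ → Carrier → Carrier
  φ ℕ.zero  x = x
  φ (suc k) x = φ k x * φ k x

  φ-cong : ∀ k {x y} → x ≈ y → φ k x ≈ φ k y
  φ-cong ℕ.zero  x≈y = x≈y
  φ-cong (suc k) x≈y = *-cong (φ-cong k x≈y) (φ-cong k x≈y)

  φ-+ : ∀ k x y → φ k (x + y) ≈ φ k x + φ k y
  φ-+ ℕ.zero  x y = refl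
  φ-+ (suc k) x y = trans (*-cong (φ-+ k x y) (φ-+ k x y))
    (solve 2 (λ a b → (a :+ b) :* (a :+ b) := a :* a :+ b :* b) refl (φ k x) (φ k y))

  φ-* : ∀ k x y → φ k (x * y) ≈ φ k x * φ k y
  φ-* ℕ.zero  x y = refl
  φ-* (suc k) x y = trans (*-cong (φ-* k x y) (φ-* k x y))
    (solve 2 (λ a b → (a :* b) :* (a :* b) := (a :* a) :* (b :* b)) refl (φ k x) (φ k y))

  φ-1 : ∀ k → φ k 1# ≈ 1#
  φ-1 ℕ.zero  = refl
  φ-1 (suc k) = trans (*-cong (φ-1 k) (φ-1 k)) (*-identityˡ 1#)

  φ-0 : ∀ k → φ k 0# ≈ 0#
  φ-0 ℕ.zero  = refl
  φ-0 (suc k) = trans (*-congˡ (φ-0 k)) (zeroʳ _)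

  φ-φ : ∀ i j x → φ (i ℕ.+ j) x ≈ φ i (φ j x)
  φ-φ ℕ.zero  j x = refl
  φ-φ (suc i) j x = *-cong (φ-φ i j x) (φ-φ i j x)

  φ≈^ : ∀ k x → x ^ (2 ℕ.^ k) ≈ φ k x
  φ≈^ ℕ.zero  x = *-identityʳ x
  φ≈^ (suc k) x = begin
    x ^ (2 ℕ.* 2 ℕ.^ k)              ≈⟨ ^-congʳ x (ℕ.*-comm 2 (2 ℕ.^ k)) ⟩
    x ^ (2 ℕ.^ k ℕ.* 2)              ≈⟨ ^-assocʳ x (2 ℕ.^ k) 2 ⟨
    (x ^ (2 ℕ.^ k)) ^ 2              ≈⟨ *-congˡ (*-identityʳ _) ⟩
    x ^ (2 ℕ.^ k) * x ^ (2 ℕ.^ k)    ≈⟨ *-cong (φ≈^ k x) (φ≈^ k x) ⟩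
    φ k x * φ k x                    ∎

  φ-inverse : ∀ k {x y} → x * y ≈ 1# → φ k x * φ k y ≈ 1#
  φ-inverse k {x} {y} xy≈1 = trans (sym (φ-* k x y)) (trans (φ-cong k xy≈1) (φ-1 k))

  φ-fix-multiple : ∀ {k x} → φ k x ≈ x → ∀ j → φ (j ℕ.* k) x ≈ x
  φ-fix-multiple         fix ℕ.zero  = refl
  φ-fix-multiple {k} {x} fix (suc j) = trans (φ-φ k (j ℕ.* k) x) (trans (φ-cong k (φ-fix-multiple fix j)) fix)

  -- Truncated traces and Artin-Schreier equations.

  Tr : ℕ → Carrier → Carrier
  Tr ℕ.zero  x = 0#
  Tr (suc k) x = Tr k x + φ k x

  Tr-cong : ∀ k {x y} → x ≈ y → Tr k x ≈ Tr k y
  Tr-cong ℕ.zero  x≈y = refl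
  Tr-cong (suc k) x≈y = +-cong (Tr-cong k x≈y) (φ-cong k x≈y)

  Tr-+ : ∀ k x y → Tr k (x + y) ≈ Tr k x + Tr k y
  Tr-+ ℕ.zero  x y = sym (+-identityˡ 0#)
  Tr-+ (suc k) x y = trans (+-cong (Tr-+ k x y) (φ-+ k x y))
    (solve 4 (λ a b p q → (a :+ b) :+ (p :+ q) := (a :+ p) :+ (b :+ q)) refl (Tr k x) (Tr k y) (φ k x) (φ k y))

  Tr-split : ∀ i j x → Tr (i ℕ.+ j) x ≈ Tr j x + Tr i (φ j x)
  Tr-split ℕ.zero  j x = sym (+-identityʳ _)
  Tr-split (suc i) j x = trans (+-cong (Tr-split i j x) (φ-φ i j x)) (+-assoc _ _ _)

  Tr-square : ∀ k x → Tr k (x * x) ≈ Tr k x * Tr k x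
  Tr-square ℕ.zero  x = sym (zeroʳ 0#)
  Tr-square (suc k) x = trans (+-cong (Tr-square k x) (φ-* k x x))
    (solve 2 (λ a b → a :* a :+ b :* b := (a :+ b) :* (a :+ b)) refl (Tr k x) (φ k x))

  -- Squaring shifts the summands of the trace by one place, so only the two end terms survive.
  Tr-telescope : ∀ k x → Tr k x * Tr k x + Tr k x ≈ φ k x + x
  Tr-telescope ℕ.zero  x = trans (trans (+-identityʳ _) (zeroʳ 0#)) (sym (x+x≈0 x))
  Tr-telescope (suc k) x = from₁ 1# (Tr-telescope k x)
    (solve 3 (λ t p x → (t :+ p) :* (t :+ p) :+ (t :+ p) :+ (p :* p :+ x) := :1 :* (t :* t :+ t :+ (p :+ x)))
      refl (Tr k x) (φ k x) x)

  Tr-artin-schreier : ∀ k x → Tr k (x * x + x) ≈ φ k x + x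
  Tr-artin-schreier k x = trans (Tr-+ k (x * x) x) (trans (+-congʳ (Tr-square k x)) (Tr-telescope k x))

  Tr-one : ∀ n {δ} → φ n δ ≈ δ + 1# → Tr n (δ * δ + δ) ≈ 1#
  Tr-one n {δ} φδ≈δ+1 = from₂ 1# (Tr-artin-schreier n δ) 1# φδ≈δ+1
    (solve 3 (λ t p d → t :+ :1 := :1 :* (t :+ (p :+ d)) :+ :1 :* (p :+ (d :+ :1))) refl (Tr n (δ * δ + δ)) (φ n δ) δ)

  -- Additive Hilbert 90 with an explicit solution: the sum of `φ k e * Tr k c` over `k < n`, whose
  -- square plus itself telescopes.
  hilbert90 : ∀ n e c → Tr n e ≈ 1# → Tr n c ≈ 0# → ∃ λ y → y * y + y ≈ c
  hilbert90 n e c Tre≈1 Trc≈0 = Y n , (begin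
    Y n * Y n + Y n                          ≈⟨ Y-artin-schreier n ⟩
    φ n e * Tr n c + c * (Tr n e * Tr n e)   ≈⟨ +-cong (trans (*-congˡ Trc≈0) (zeroʳ _))
                                                  (*-congˡ (trans (*-cong Tre≈1 Tre≈1) (*-identityˡ 1#))) ⟩
    0# + c * 1#                              ≈⟨ trans (+-identityˡ _) (*-identityʳ c) ⟩
    c                                        ∎)
    where
    Y : ℕ → Carrier
    Y ℕ.zero  = 0#
    Y (suc k) = Y k + φ k e * Tr k c
    Y-artin-schreier : ∀ k → Y k * Y k + Y k ≈ φ k e * Tr k c + c * (Tr k e * Tr k e)
    Y-artin-schreier ℕ.zero  = solve 2 (λ e c → :0 :* :0 :+ :0 := e :* :0 :+ c :* (:0 :* :0)) refl e c
    Y-artin-schreier (suc k) = from₂ 1# (Y-artin-schreier k) (φ k e * φ k e) (Tr-telescope k c)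
      (solve 6 (λ y p t u e c →
          let y′ = y :+ p :* t in
          y′ :* y′ :+ y′ :+ (p :* p :* (t :+ u) :+ c :* ((e :+ p) :* (e :+ p)))
            := :1 :* (y :* y :+ y :+ (p :* t :+ c :* (e :* e))) :+ p :* p :* (t :* t :+ t :+ (u :+ c)))
        refl (Y k) (φ k e) (Tr k c) (φ k c) (Tr k e) c)

  -- An element of the quadratic extension of the fixed field of φ n provides an
  -- element of trace one, which also absorbs a right-hand side of trace one.
  artin-schreier-solvable : ∀ n {δ c} → φ n δ ≈ δ + 1# → φ n c ≈ c → ∃ λ y → y * y + y ≈ c
  artin-schreier-solvable n {δ} {c} φδ≈δ+1 φc≈c
    with integral {Tr n c} {Tr n c + 1#} (from₂ 1# (Tr-telescope n c) 1# φc≈c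
      (solve 3 (λ t p c → t :* (t :+ :1) :+ :0 := :1 :* (t :* t :+ t :+ (p :+ c)) :+ :1 :* (p :+ c)) refl (Tr n c) (φ n c) c))
  ... | inj₁ Trc≈0 = hilbert90 n (δ * δ + δ) c (Tr-one n φδ≈δ+1) Trc≈0
  ... | inj₂ Trc+1≈0 = proj₁ sol + δ , from₁ 1# (proj₂ sol)
      (solve 3 (λ y d c → (y :+ d) :* (y :+ d) :+ (y :+ d) :+ c := :1 :* (y :* y :+ y :+ (c :+ (d :* d :+ d)))) refl (proj₁ sol) δ c)
    where
    sol = hilbert90 n (δ * δ + δ) (c + (δ * δ + δ)) (Tr-one n φδ≈δ+1)
      (trans (Tr-+ n _ _) (trans (+-congˡ (Tr-one n φδ≈δ+1)) Trc+1≈0))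

  -- The third summation polynomial of the curve, `(x y + x z + y z)² + x y z + 1`.

  G : Carrier → Carrier → Carrier → Carrier
  G x y z = x * x * (y * y) + x * x * (z * z) + y * y * (z * z) + x * y * z + 1#

  :G : ∀ {k} → Polynomial k → Polynomial k → Polynomial k → Polynomial k
  :G x y z = x :* x :* (y :* y) :+ x :* x :* (z :* z) :+ y :* y :* (z :* z) :+ x :* y :* z :+ :1

  G-cong : ∀ {x x′ y y′ z z′} → x ≈ x′ → y ≈ y′ → z ≈ z′ → G x y z ≈ G x′ y′ z′
  G-cong p q r = +-congʳ (+-cong (+-cong (+-cong (*-cong (*-cong p p) (*-cong q q)) (*-cong (*-cong p p) (*-cong r r)))
    (*-cong (*-cong q q) (*-cong r r))) (*-cong (*-cong p q) r))

  G-swap : ∀ x y z → G x y z ≈ G y x z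
  G-swap = solve 3 (λ x y z → :G x y z := :G y x z) refl

  G-rotate : ∀ x y z → G x y z ≈ G z x y
  G-rotate = solve 3 (λ x y z → :G x y z := :G z x y) refl

  -- The coefficients of `G` lie in F₂, so `G` commutes with squaring.
  G-φ : ∀ k {x y z} → G x y z ≈ 0# → G (φ k x) (φ k y) (φ k z) ≈ 0#
  G-φ ℕ.zero  Gxyz≈0 = Gxyz≈0
  G-φ (suc k) {x} {y} {z} Gxyz≈0 = trans
    (solve 3 (λ x y z → :G (x :* x) (y :* y) (z :* z) := :G x y z :* :G x y z) refl (φ k x) (φ k y) (φ k z))
    (trans (*-congˡ (G-φ k Gxyz≈0)) (zeroʳ _))

  -- G x y z + x² G x̄ y z = ((x + 1) (y + 1) (z + 1))².
  G-invert-degenerate : ∀ {x x̄ y z} → x * x̄ ≈ 1# → G x y z ≈ 0# → G x̄ y z ≈ 0# → x ≈ 1# ⊎ y ≈ 1# ⊎ z ≈ 1#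
  G-invert-degenerate {x} {x̄} {y} {z} xx̄≈1 Gx≈0 Gx̄≈0
    with integral (square≈0 (from₃ 1# Gx≈0 (x * x) Gx̄≈0 ((x * x̄ + 1#) * (y * y + z * z) + x * y * z) xx̄≈1
      (solve 4 (λ x x̄ y z →
          let p = (x :+ :1) :* ((y :+ :1) :* (z :+ :1)) in
          p :* p :+ :0 := :1 :* (:G x y z :+ :0) :+ x :* x :* (:G x̄ y z :+ :0)
            :+ ((x :* x̄ :+ :1) :* (y :* y :+ z :* z) :+ x :* y :* z) :* (x :* x̄ :+ :1)) refl x x̄ y z)))
  ... | inj₁ x+1≈0 = inj₁ (+≈0⇒≈ x+1≈0)
  ... | inj₂ yz≈0  = inj₂ ([ inj₁ ∘ +≈0⇒≈ , inj₂ ∘ +≈0⇒≈ ]′ (integral yz≈0))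

  -- (x y z)² G (θ x) (θ y) (θ z) = G x y z · z² G x y z̄.
  G-lift : ∀ {x x̄ y ȳ z z̄} → x * x̄ ≈ 1# → y * ȳ ≈ 1# → z * z̄ ≈ 1# →
           G (x + x̄) (y + ȳ) (z + z̄) ≈ 0# → G x y z ≈ 0# ⊎ G x y z̄ ≈ 0#
  G-lift {x} {x̄} {y} {ȳ} {z} {z̄} xx̄≈1 yȳ≈1 zz̄≈1 Gθ≈0 = conclude (integral (begin
    G x y z * (z * z * G x y z̄)     ≈⟨ *-congˡ G-clear ⟩
    G x y z * (x * x + y * y + x * y * z + z * z * (x * x * (y * y) + 1#))
      ≈⟨ solve 3 (λ x y z → :G x y z :* (x :* x :+ y :* y :+ x :* y :* z :+ z :* z :* (x :* x :* (y :* y) :+ :1))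
           := :K (x :* x :+ :1) (y :* y :+ :1) (z :* z :+ :1) x y z) refl x y z ⟩
    K (x * x + 1#) (y * y + 1#) (z * z + 1#) x y z
      ≈⟨ K-cong (clear-denominator xx̄≈1) (clear-denominator yȳ≈1) (clear-denominator zz̄≈1) ⟨
    K ((x + x̄) * x) ((y + ȳ) * y) ((z + z̄) * z) x y z
      ≈⟨ solve 6 (λ a b c x y z → :K (a :* x) (b :* y) (c :* z) x y z := (x :* y :* z) :* (x :* y :* z) :* :G a b c)
           refl (x + x̄) (y + ȳ) (z + z̄) x y z ⟩
    (x * y * z) * (x * y * z) * G (x + x̄) (y + ȳ) (z + z̄)  ≈⟨ trans (*-congˡ Gθ≈0) (zeroʳ _) ⟩
    0# ∎))
    where
    -- `K a b c x y z` is `(x y z)² G (a/x) (b/y) (c/z)` with denominators cleared.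
    K : Carrier → Carrier → Carrier → Carrier → Carrier → Carrier → Carrier
    K a b c x y z = a * a * (b * b) * (z * z) + a * a * (c * c) * (y * y) + b * b * (c * c) * (x * x)
      + a * b * c * (x * y * z) + x * x * (y * y) * (z * z)
    :K : ∀ {k} → Polynomial k → Polynomial k → Polynomial k → Polynomial k → Polynomial k → Polynomial k → Polynomial k
    :K a b c x y z = a :* a :* (b :* b) :* (z :* z) :+ a :* a :* (c :* c) :* (y :* y) :+ b :* b :* (c :* c) :* (x :* x)
      :+ a :* b :* c :* (x :* y :* z) :+ x :* x :* (y :* y) :* (z :* z)
    K-cong : ∀ {a a′ b b′ c c′ x y z} → a ≈ a′ → b ≈ b′ → c ≈ c′ → K a b c x y z ≈ K a′ b′ c′ x y z
    K-cong p q r = +-congʳ (+-cong (+-cong (+-cong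
      (*-congʳ (*-cong (*-cong p p) (*-cong q q))) (*-congʳ (*-cong (*-cong p p) (*-cong r r))))
      (*-congʳ (*-cong (*-cong q q) (*-cong r r)))) (*-congʳ (*-cong (*-cong p q) r)))
    G-clear : z * z * G x y z̄ ≈ x * x + y * y + x * y * z + z * z * (x * x * (y * y) + 1#)
    G-clear = from₁ ((z * z̄ + 1#) * (x * x + y * y) + x * y * z) zz̄≈1
      (solve 4 (λ x y z z̄ →
          z :* z :* :G x y z̄ :+ (x :* x :+ y :* y :+ x :* y :* z :+ z :* z :* (x :* x :* (y :* y) :+ :1))
            := ((z :* z̄ :+ :1) :* (x :* x :+ y :* y) :+ x :* y :* z) :* (z :* z̄ :+ :1)) refl x y z z̄)
    conclude : G x y z ≈ 0# ⊎ z * z * G x y z̄ ≈ 0# → G x y z ≈ 0# ⊎ G x y z̄ ≈ 0#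
    conclude (inj₁ eq) = inj₁ eq
    conclude (inj₂ eq) = inj₂ ([ (λ zz≈0 → contradiction (square≈0 zz≈0) (unit-nonzero zz̄≈1)) , (λ e → e) ]′ (integral eq))

  -- Iterated preimages of 1 and their conjugates.

  -- r lies on level s of the preimage tree 1 ← ω₁ ← ω₂ ← ⋯ of 1 under θ; level s
  -- generates the field with 2 ^ 2 ^ s elements.
  record TowerLevel (s : ℕ) (r r̄ : Carrier) : Set ℓ where
    field
      inv      : r * r̄ ≈ 1#
      trace    : Tr (2 ℕ.^ s) r ≈ 1#
      trace⁻¹  : Tr (2 ℕ.^ s) r̄ ≈ 1#
      fixed    : φ (2 ℕ.^ s) r ≈ r
      inverted : ∀ {t} → s ≡ suc t → φ (2 ℕ.^ t) r ≈ r̄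

  open TowerLevel

  -- `G-lift` produces a preimage or its inverse without saying which, so levels have to be closed
  -- under inversion.
  tower-invert : ∀ {s r r̄} → TowerLevel s r r̄ → TowerLevel s r̄ r
  tower-invert {s} {r} {r̄} T = record
    { inv      = r̄r≈1
    ; trace    = trace⁻¹ T
    ; trace⁻¹  = trace T
    ; fixed    = inverse-unique (trans (*-congʳ (sym (fixed T))) (φ-inverse (2 ℕ.^ s) (inv T))) (inv T)
    ; inverted = λ {t} s≡1+t → inverse-unique
        (trans (*-congʳ (sym (inverted T s≡1+t))) (φ-inverse (2 ℕ.^ t) (inv T))) r̄r≈1
    }
    where r̄r≈1 = trans (*-comm r̄ r) (inv T)

  tower-base : TowerLevel 0 1# 1#
  tower-base = record
    { inv = *-identityˡ 1# ; trace = +-identityˡ 1# ; trace⁻¹ = +-identityˡ 1#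
    ; fixed = *-identityˡ 1# ; inverted = λ () }

  -- For `s ≥ 1` the trace of 1 adds an even number of ones and vanishes, whereas `r` has trace one.
  tower-≉1 : ∀ {s r r̄} → 1 ℕ.≤ s → TowerLevel s r r̄ → ¬ (r ≈ 1#)
  tower-≉1 {suc s} {r} _ T r≈1 = 1≉0 (begin
    1#                      ≈⟨ trace T ⟨
    Tr (k ℕ.+ (k ℕ.+ 0)) r  ≈⟨ Tr-cong (k ℕ.+ (k ℕ.+ 0)) r≈1 ⟩
    Tr (k ℕ.+ (k ℕ.+ 0)) 1# ≡⟨ ≡.cong (λ j → Tr (k ℕ.+ j) 1#) (ℕ.+-identityʳ k) ⟩
    Tr (k ℕ.+ k) 1#         ≈⟨ Tr-split k k 1# ⟩
    Tr k 1# + Tr k (φ k 1#) ≈⟨ +-congˡ (Tr-cong k (φ-1 k)) ⟩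
    Tr k 1# + Tr k 1#       ≈⟨ x+x≈0 _ ⟩
    0#                      ∎)
    where k = 2 ℕ.^ s

  -- With r′ = r y, the equation r′ + 1/r′ = r becomes y² + y = 1/r², and the
  -- 2 ^ s-fold Frobenius shifts y by the trace of 1/r², which is one.
  tower-step : ∀ n {s r r̄ δ} → φ n δ ≈ δ + 1# → φ n r ≈ r → TowerLevel s r r̄ →
               ∃₂ λ r′ r̄′ → TowerLevel (suc s) r′ r̄′ × r′ + r̄′ ≈ r
  tower-step n {s} {r} {r̄} {δ} φδ≈δ+1 φr≈r T = r′ , r̄′ , T′ , r′+r̄′≈r
    where
    k = 2 ℕ.^ s
    φr̄≈r̄ : φ n r̄ ≈ r̄
    φr̄≈r̄ = inverse-unique (trans (*-congʳ (sym φr≈r)) (φ-inverse n (inv T))) (inv T)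
    sol = artin-schreier-solvable n φδ≈δ+1 (trans (φ-* n r̄ r̄) (*-cong φr̄≈r̄ φr̄≈r̄))
    y = proj₁ sol
    r′ = r * y
    -- The second root `r * (y + 1)` of `X² + r X + 1`, hence the inverse of `r′`.
    r̄′ = r * y + r
    r′+r̄′≈r : r′ + r̄′ ≈ r
    r′+r̄′≈r = solve 2 (λ a r → a :+ (a :+ r) := r) refl r′ r
    r′r̄′≈1 : r′ * r̄′ ≈ 1#
    r′r̄′≈1 = from₂ (r * r) (proj₂ sol) (r * r̄ + 1#) (inv T)
      (solve 3 (λ r r̄ y → r :* y :* (r :* y :+ r) :+ :1
        := r :* r :* (y :* y :+ y :+ r̄ :* r̄) :+ (r :* r̄ :+ :1) :* (r :* r̄ :+ :1)) refl r r̄ y)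
    φy≈y+1 : φ k y ≈ y + 1#
    φy≈y+1 = from₁ 1# (begin
      φ k y + y             ≈⟨ Tr-artin-schreier k y ⟨
      Tr k (y * y + y)      ≈⟨ Tr-cong k (proj₂ sol) ⟩
      Tr k (r̄ * r̄)          ≈⟨ Tr-square k r̄ ⟩
      Tr k r̄ * Tr k r̄       ≈⟨ *-cong (trace⁻¹ T) (trace⁻¹ T) ⟩
      1# * 1#               ≈⟨ *-identityˡ 1# ⟩
      1#                    ∎)
      (solve 2 (λ p y → p :+ (y :+ :1) := :1 :* (p :+ y :+ :1)) refl (φ k y) y)
    φr′≈r̄′ : φ k r′ ≈ r̄′
    φr′≈r̄′ = begin
      φ k (r * y)    ≈⟨ φ-* k r y ⟩
      φ k r * φ k y  ≈⟨ *-cong (fixed T) φy≈y+1 ⟩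
      r * (y + 1#)   ≈⟨ solve 2 (λ r y → r :* (y :+ :1) := r :* y :+ r) refl r y ⟩
      r * y + r      ∎
    φr̄′≈r′ : φ k r̄′ ≈ r′
    φr̄′≈r′ = inverse-unique (trans (*-congʳ (sym φr′≈r̄′)) (φ-inverse k r′r̄′≈1)) (trans (*-comm r̄′ r′) r′r̄′≈1)
    double : ∀ {a} {A : Set a} (f : ℕ → A) → f (2 ℕ.^ suc s) ≡ f (k ℕ.+ k)
    double f = ≡.cong (λ j → f (k ℕ.+ j)) (ℕ.+-identityʳ k)
    -- Transitivity of the trace: `x` and its conjugate add up to `r`, which has trace one.
    trace-conjugates : ∀ {x x̄} → φ k x ≈ x̄ → x + x̄ ≈ r → Tr (2 ℕ.^ suc s) x ≈ 1#
    trace-conjugates {x} {x̄} φx≈x̄ x+x̄≈r = begin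
      Tr (2 ℕ.^ suc s) x    ≡⟨ double (λ j → Tr j x) ⟩
      Tr (k ℕ.+ k) x        ≈⟨ Tr-split k k x ⟩
      Tr k x + Tr k (φ k x) ≈⟨ Tr-+ k x (φ k x) ⟨
      Tr k (x + φ k x)      ≈⟨ Tr-cong k (trans (+-congˡ φx≈x̄) x+x̄≈r) ⟩
      Tr k r                ≈⟨ trace T ⟩
      1#                    ∎
    T′ : TowerLevel (suc s) r′ r̄′
    T′ = record
      { inv      = r′r̄′≈1
      ; trace    = trace-conjugates φr′≈r̄′ r′+r̄′≈r
      ; trace⁻¹  = trace-conjugates φr̄′≈r′ (trans (+-comm r̄′ r′) r′+r̄′≈r)
      ; fixed    = begin
          φ (2 ℕ.^ suc s) r′  ≡⟨ double (λ j → φ j r′) ⟩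
          φ (k ℕ.+ k) r′      ≈⟨ φ-φ k k r′ ⟩
          φ k (φ k r′)        ≈⟨ φ-cong k φr′≈r̄′ ⟩
          φ k r̄′              ≈⟨ φr̄′≈r′ ⟩
          r′                  ∎
      ; inverted = λ where ≡.refl → φr′≈r̄′
      }

  -- `φ k` acts on `x` and its inverse as a swap, so an odd number of applications acts like one.
  φ-inverted-odd : ∀ {k x x̄} → x * x̄ ≈ 1# → φ k x ≈ x̄ → ∀ j → φ (suc (j ℕ.* 2) ℕ.* k) x ≈ x̄
  φ-inverted-odd {k} {x} {x̄} xx̄≈1 φx≈x̄ j = begin
    φ (k ℕ.+ j ℕ.* 2 ℕ.* k) x    ≈⟨ φ-φ k (j ℕ.* 2 ℕ.* k) x ⟩
    φ k (φ (j ℕ.* 2 ℕ.* k) x)    ≡⟨ ≡.cong (λ i → φ k (φ i x)) (ℕ.*-assoc j 2 k) ⟩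
    φ k (φ (j ℕ.* (2 ℕ.* k)) x)  ≈⟨ φ-cong k (φ-fix-multiple fix j) ⟩
    φ k x                        ≈⟨ φx≈x̄ ⟩
    x̄                            ∎
    where
    fix : φ (2 ℕ.* k) x ≈ x
    fix = begin
      φ (k ℕ.+ (k ℕ.+ 0)) x  ≡⟨ ≡.cong (λ i → φ (k ℕ.+ i) x) (ℕ.+-identityʳ k) ⟩
      φ (k ℕ.+ k) x          ≈⟨ φ-φ k k x ⟩
      φ k (φ k x)            ≈⟨ φ-cong k φx≈x̄ ⟩
      φ k x̄                  ≈⟨ inverse-unique (trans (*-congʳ (sym φx≈x̄)) (φ-inverse k xx̄≈1)) (trans (*-comm x̄ x) xx̄≈1) ⟩
      x                      ∎

  -- Orbits of θ and the q-power Frobenius.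

  orbit : Carrier → ℕ → Carrier
  orbit γ ℕ.zero  = γ
  orbit γ (suc j) = orbit γ j + (orbit γ j) ⁻¹

  module Dynamics (n : ℕ) where

    σ : Carrier → Carrier
    σ = φ n

    Mixed : Pred Carrier ℓ
    Mixed x = σ (σ x) ≈ x × ¬ (σ x ≈ x) × ¬ (σ x * x ≈ 1#)

    σ-unfixed⇒≉0 : ∀ {x} → ¬ (σ x ≈ x) → ¬ (x ≈ 0#)
    σ-unfixed⇒≉0 σx≉x x≈0 = σx≉x (trans (φ-cong n x≈0) (trans (φ-0 n) (sym x≈0)))

    MixedOrbit : Carrier → ℕ → Set ℓ
    MixedOrbit γ i = ∀ j → 1 ℕ.≤ j → j ℕ.≤ i → Mixed (orbit γ j)

    orbit-≉0 : ∀ {γ p} → ¬ (γ ≈ 0#) → MixedOrbit γ p → ∀ j → j ℕ.≤ p → ¬ (orbit γ j ≈ 0#)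
    orbit-≉0 γ≉0 mixed ℕ.zero  _   = γ≉0
    orbit-≉0 γ≉0 mixed (suc j) j≤p = σ-unfixed⇒≉0 (proj₁ (proj₂ (mixed (suc j) (ℕ.s≤s ℕ.z≤n) j≤p)))

    σ-trivial⇒1 : ∀ {x} → σ (σ x) * x ≈ 1# → σ (σ x) ≈ x → x ≈ 1#
    σ-trivial⇒1 σσx*x≈1 σσx≈x = square≈1 (trans (*-congʳ (sym σσx≈x)) σσx*x≈1)

    sum-of-conjugates-fixed : ∀ {x x̄ y ȳ} → σ x ≈ y → σ x̄ ≈ ȳ → y + ȳ ≈ x + x̄ → σ (x + x̄) ≈ x + x̄
    sum-of-conjugates-fixed σx≈y σx̄≈ȳ eq = trans (φ-+ n _ _) (trans (+-cong σx≈y σx̄≈ȳ) eq)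

    σ-⁻¹ : ∀ {x y} → ¬ (x ≈ 0#) → σ x * y ≈ 1# → σ (x ⁻¹) ≈ y
    σ-⁻¹ x≉0 = inverse-unique (φ-inverse n (⁻¹-inverseʳ x≉0))

    -- σ commutes with θ, and `σ x` has the same image as `x` only if it is `x` or its inverse.
    θ-unfixed : ∀ {x} → ¬ (x ≈ 0#) → ¬ (σ x ≈ x) → ¬ (σ x * x ≈ 1#) → ¬ (σ (x + x ⁻¹) ≈ x + x ⁻¹)
    θ-unfixed {x} x≉0 σx≉x σx*x≉1 eq =
      [ σx≉x , σx*x≉1 ]′ (sum-of-inverses-injective (⁻¹-inverseʳ x≉0) (φ-inverse n (⁻¹-inverseʳ x≉0))
        (trans (sym (φ-+ n x (x ⁻¹))) eq))

    -- The sum `u + σ u` is nonzero and fixed by σ; dividing `u` by it normalises the difference of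
    -- conjugates to 1.
    quadratic-generator : ∀ {u} → Mixed u → ∃ λ δ → σ δ ≈ δ + 1#
    quadratic-generator {u} (σσu≈u , σu≉u , _) = u * s ⁻¹ , (begin
      σ (u * s ⁻¹)      ≈⟨ φ-* n u (s ⁻¹) ⟩
      σ u * σ (s ⁻¹)    ≈⟨ *-congˡ (σ-⁻¹ s≉0 (trans (*-congʳ σs≈s) (⁻¹-inverseʳ s≉0))) ⟩
      σ u * s ⁻¹        ≈⟨ solve 3 (λ u v t → v :* t := u :* t :+ (u :+ v) :* t) refl u (σ u) (s ⁻¹) ⟩
      u * s ⁻¹ + s * s ⁻¹ ≈⟨ +-congˡ (⁻¹-inverseʳ s≉0) ⟩
      u * s ⁻¹ + 1#     ∎)
      where
      s = u + σ u
      s≉0 : ¬ (s ≈ 0#)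
      s≉0 s≈0 = σu≉u (sym (+≈0⇒≈ s≈0))
      σs≈s : σ s ≈ s
      σs≈s = sum-of-conjugates-fixed refl σσu≈u (+-comm (σ u) u)

    -- The length of a mixed run that ends.

    module _ (l m : ℕ) (2∤m : 2 ∤ m) (n≡2^l*m : n ≡ 2 ℕ.^ l ℕ.* m)
             {γ : Carrier} (γ≉1 : ¬ (γ ≈ 1#)) (σσγ*γ≈1 : σ (σ γ) * γ ≈ 1#)
             (p : ℕ) (1≤p : 1 ℕ.≤ p) (mixed : MixedOrbit γ p)
             (exit : σ (orbit γ (suc p)) * orbit γ (suc p) ≈ 1#) where

      private
        a : ℕ → Carrier
        a = orbit γ

        a≉0 : ∀ j → j ℕ.≤ p → ¬ (a j ≈ 0#)
        a≉0 = orbit-≉0 (unit-nonzero (trans (*-comm γ _) σσγ*γ≈1)) mixed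

        -- Since `1 ≤ p`, the first iterate is mixed and supplies the element needed to solve
        -- Artin-Schreier equations.
        δ,σδ = quadratic-generator (mixed 1 ℕ.≤-refl 1≤p)

        -- For `s ≤ l` the degree `2 ^ s` divides `n`.
        low-level-fixed : ∀ {s r r̄} → s ℕ.≤ l → TowerLevel s r r̄ → σ r ≈ r
        low-level-fixed {s} {r} s≤l T = begin
          φ n r                                    ≡⟨ ≡.cong (λ i → φ i r) n≡ ⟩
          φ (m ℕ.* 2 ℕ.^ (l ℕ.∸ s) ℕ.* 2 ℕ.^ s) r  ≈⟨ φ-fix-multiple {2 ℕ.^ s} (fixed T) (m ℕ.* 2 ℕ.^ (l ℕ.∸ s)) ⟩
          r                                        ∎
          where
          n≡ = ≡.trans n≡2^l*m (2^l*m-factor m s≤l)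

        -- `n` is an odd multiple of `2 ^ l`, and `φ (2 ^ l)` inverts level `l + 1`.
        top-level-inverted : ∀ {r r̄} → TowerLevel (suc l) r r̄ → σ r ≈ r̄
        top-level-inverted {r} {r̄} T = begin
          φ n r                               ≡⟨ ≡.cong (λ i → φ i r) n≡ ⟩
          φ (suc (m / 2 ℕ.* 2) ℕ.* 2 ℕ.^ l) r ≈⟨ φ-inverted-odd {2 ℕ.^ l} (inv T) (inverted T ≡.refl) (m / 2) ⟩
          r̄                                   ∎
          where
          n≡ : n ≡ suc (m / 2 ℕ.* 2) ℕ.* 2 ℕ.^ l
          n≡ = ≡.trans n≡2^l*m (≡.trans (ℕ.*-comm (2 ℕ.^ l) m) (≡.cong (ℕ._* 2 ℕ.^ l) (odd-decomposition 2∤m)))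

        -- Climbing the orbit from its exit point back towards γ, the "difference"
        -- of a j and its conjugate climbs the tower.
        climb : ∀ s j → s ℕ.+ j ≡ p → s ℕ.≤ suc l →
                ∃₂ λ r r̄ → TowerLevel s r r̄ × G (a j) (σ (a j)) r ≈ 0#
        -- With `w = σ z`, `G z w 1` equals `w z (θ w · θ z + 1)`, and the exit condition says that
        -- `θ w · θ z` is 1.
        climb ℕ.zero j ≡.refl _ = 1# , 1# , tower-base , (begin
          G z w 1#                        ≈⟨ solve 2 (λ z w → :G z w :1 := (z :* z :+ :1) :* (w :* w :+ :1) :+ w :* z) refl z w ⟩
          (z * z + 1#) * (w * w + 1#) + w * z
            ≈⟨ +-congʳ (*-cong (clear-denominator zz̄≈1) (clear-denominator ww̄≈1)) ⟨
          ((z + z̄) * z) * ((w + w̄) * w) + w * z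
            ≈⟨ solve 4 (λ A B z w → (A :* z) :* (B :* w) :+ w :* z := (B :* A :+ :1) :* (w :* z)) refl (z + z̄) (w + w̄) z w ⟩
          ((w + w̄) * (z + z̄) + 1#) * (w * z)  ≈⟨ *-congʳ (≈⇒+≈0 (trans (*-congʳ (sym (φ-+ n z z̄))) exit)) ⟩
          0# * (w * z)                    ≈⟨ zeroˡ _ ⟩
          0#                              ∎)
          where
          z = a j
          z̄ = z ⁻¹
          w = σ z
          w̄ = σ z̄
          zz̄≈1 = ⁻¹-inverseʳ (a≉0 j ℕ.≤-refl)
          ww̄≈1 = φ-inverse n zz̄≈1
        climb (suc s) j s+j≡p s<l =
          let (r , _ , T , Gr≈0) = climb s (suc j) (≡.trans (ℕ.+-suc s j) s+j≡p) (ℕ.<⇒≤ s<l)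
              (δ , σδ≈δ+1) = δ,σδ
              -- Solvability needs `r` fixed by σ, which holds up to level `l`; the climb can
              -- therefore reach level `l + 1`.
              (r′ , r̄′ , T′ , r′+r̄′≈r) = tower-step n σδ≈δ+1 (low-level-fixed (ℕ.≤-pred s<l) T) T
              zz̄≈1 = ⁻¹-inverseʳ (a≉0 j (ℕ.≤-trans (ℕ.m≤n+m j (suc s)) (ℕ.≤-reflexive s+j≡p)))
          in [ (λ G≈0 → r′ , r̄′ , T′ , G≈0) , (λ G≈0 → r̄′ , r′ , tower-invert T′ , G≈0) ]′
               (G-lift zz̄≈1 (φ-inverse n zz̄≈1) (inv T′)
                 (trans (G-cong refl (sym (φ-+ n _ _)) r′+r̄′≈r) Gr≈0))

        -- The climb reaches γ at a level whose `r` is fixed by σ. As `σ (σ γ)` is the inverse of γ,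
        -- applying σ to `G γ (σ γ) r = 0` inverts just one argument, so γ, `σ γ` or `r` would be 1.
        too-early : ¬ (p ℕ.< suc l)
        too-early p<1+l =
          let (r , r̄ , T , G≈0) = climb p 0 (ℕ.+-identityʳ p) (ℕ.<⇒≤ p<1+l)
              G′≈0 = trans (G-cong refl refl (sym (low-level-fixed (ℕ.≤-pred p<1+l) T)))
                           (trans (G-swap _ _ _) (G-φ n G≈0))
          in [ γ≉1 , [ σγ≉1 , tower-≉1 1≤p T ]′ ]′
               (G-invert-degenerate (trans (*-comm γ _) σσγ*γ≈1) G≈0 G′≈0)
          where
          σγ≉1 : ¬ (σ γ ≈ 1#)
          σγ≉1 σγ≈1 = γ≉1 (trans (sym (*-identityˡ γ))
            (trans (*-congʳ (sym (trans (φ-cong n σγ≈1) (φ-1 n)))) σσγ*γ≈1))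

        -- The climb stops at level `l + 1` on a mixed `z`. Here σ swaps `z` with `σ z` and inverts
        -- `r`, so applying it to `G z (σ z) r = 0` forces `r`, `z` or `σ z` to be 1.
        too-late : ¬ (suc l ℕ.< p)
        too-late 1+l<p =
          let (r , r̄ , T , G≈0) = climb (suc l) j (ℕ.m+[n∸m]≡n (ℕ.<⇒≤ 1+l<p)) ℕ.≤-refl
              G′≈0 = begin
                G r̄ z (σ z)            ≈⟨ G-cong (top-level-inverted T) σσz≈z refl ⟨
                G (σ r) (σ (σ z)) (σ z) ≈⟨ G-swap _ _ _ ⟩
                G (σ (σ z)) (σ r) (σ z) ≈⟨ G-rotate _ _ _ ⟩
                G (σ z) (σ (σ z)) (σ r) ≈⟨ G-φ n G≈0 ⟩
                0#                      ∎
          in [ tower-≉1 (ℕ.s≤s ℕ.z≤n) T , [ z≉1 , (λ σz≈1 → z≉1 (trans (sym σσz≈z) (trans (φ-cong n σz≈1) (φ-1 n)))) ]′ ]′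
               (G-invert-degenerate (inv T) (trans (sym (G-rotate _ _ _)) G≈0) G′≈0)
          where
          j = p ℕ.∸ suc l
          z-mixed = mixed j (ℕ.m<n⇒0<n∸m 1+l<p) (ℕ.m∸n≤m p (suc l))
          z = a j
          σσz≈z = proj₁ z-mixed
          z≉1 : ¬ (z ≈ 1#)
          z≉1 z≈1 = proj₁ (proj₂ z-mixed) (trans (φ-cong n z≈1) (trans (φ-1 n) (sym z≈1)))

      mixed-length : p ≡ suc l
      mixed-length = ℕ.≤-antisym (ℕ.≮⇒≥ too-late) (ℕ.≮⇒≥ too-early)

    -- Multiplicative orders read off from the action of σ.

    private
      q : ℕ
      q = 2 ℕ.^ n

      0<q : 0 ℕ.< q
      0<q = ℕ.m^n>0 2 n

    ^q : ∀ x → x * x ^ (q ℕ.∸ 1) ≈ σ x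
    ^q x = trans (^-congʳ x (ℕ.m+[n∸m]≡n 0<q)) (φ≈^ n x)

    ^[q+1] : ∀ x → x ^ (q ℕ.+ 1) ≈ σ x * x
    ^[q+1] x = trans (^-homo-* x q 1) (*-cong (φ≈^ n x) (*-identityʳ x))

    fixed⇒^≈1 : ∀ {x} → ¬ (x ≈ 0#) → σ x ≈ x → x ^ (q ℕ.∸ 1) ≈ 1#
    fixed⇒^≈1 {x} x≉0 σx≈x = *-cancelˡ x≉0 (trans (^q x) (trans σx≈x (sym (*-identityʳ x))))

    fixed⇒ord∣ : ∀ {x} → σ x ≈ x → ord F (fin x) ∣ q ℕ.∸ 1
    fixed⇒ord∣ {x} σx≈x =
      [ (λ x≈0 → ≡.subst (_∣ q ℕ.∸ 1) (≡.sym (ord-zero x≈0)) (1∣ _))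
      , (λ x≉0 → IsOrder⇒∣ (ord-isOrder x≉0) (q ℕ.∸ 1) (fixed⇒^≈1 x≉0 σx≈x)) ]′ (toSum (x ≟ 0#))

    norm-one⇒ord∣ : ∀ {x} → σ x * x ≈ 1# → ord F (fin x) ∣ q ℕ.+ 1
    norm-one⇒ord∣ {x} σx*x≈1 = IsOrder⇒∣ (ord-isOrder (unit-nonzero (trans (*-comm x _) σx*x≈1)))
      (q ℕ.+ 1) (trans (^[q+1] x) σx*x≈1)

    -- The norm `σ x * x` is fixed by σ, so the order divides `(q + 1) * (q - 1)`; it divides
    -- neither factor, since `x` is neither inverted nor fixed.
    Mixed⇒HasMixedOrder : ∀ {x} → Mixed x → HasMixedOrder F q (fin x)
    Mixed⇒HasMixedOrder {x} (σσx≈x , σx≉x , σx*x≉1) = divisor-split (proj₁ o-isOrder)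
      (IsOrder⇒∣ o-isOrder _ (begin
        x ^ ((q ℕ.+ 1) ℕ.* (q ℕ.∸ 1))   ≈⟨ ^-assocʳ x (q ℕ.+ 1) (q ℕ.∸ 1) ⟨
        (x ^ (q ℕ.+ 1)) ^ (q ℕ.∸ 1)     ≈⟨ ^-congˡ (q ℕ.∸ 1) (^[q+1] x) ⟩
        (σ x * x) ^ (q ℕ.∸ 1)           ≈⟨ fixed⇒^≈1 (*-nonzero σx≉0 x≉0)
                                             (trans (φ-* n (σ x) x) (trans (*-congʳ σσx≈x) (*-comm x (σ x)))) ⟩
        1#                              ∎))
      (λ o∣q+1 → σx*x≉1 (trans (sym (^[q+1] x)) (ord∣⇒^≈1 x≉0 o∣q+1)))
      (λ o∣q-1 → σx≉x (trans (sym (^q x)) (trans (*-congˡ (ord∣⇒^≈1 x≉0 o∣q-1)) (*-identityʳ x))))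
      where
      x≉0 = σ-unfixed⇒≉0 σx≉x
      σx≉0 : ¬ (σ x ≈ 0#)
      σx≉0 σx≈0 = x≉0 (trans (sym σσx≈x) (trans (φ-cong n σx≈0) (φ-0 n)))
      o-isOrder = ord-isOrder x≉0

    -- Otherwise the factor `e > 1` of the order would divide both odd neighbours of `q`.
    HasMixedOrder⇒∤ : 2 ∣ q → ∀ P → HasMixedOrder F q P → ord F P ∤ q ℕ.+ 1
    HasMixedOrder⇒∤ 2∣q _ (d , e , _ , 1<e , _ , e∣q-1 , o≡d*e) o∣q+1 =
      even⇒neighbours-coprime 0<q 2∣q (∣-trans (≡.subst (e ∣_) (≡.sym o≡d*e) (n∣m*n d)) o∣q+1) e∣q-1 1<e

    -- Stability under θ of the projective line over the fixed field of σ.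

    InSubfield : Pred (P¹ F) ℓ
    InSubfield ∞       = ⊤
    InSubfield (fin x) = σ x ≈ x

    InSubfield⇒ord∣ : ∀ P → InSubfield P → ord F P ∣ q ℕ.∸ 1
    InSubfield⇒ord∣ ∞       _    = 1∣ _
    InSubfield⇒ord∣ (fin x) σx≈x = fixed⇒ord∣ σx≈x

    θ-InSubfield : ∀ P → InSubfield P → InSubfield (θ F P)
    θ-InSubfield ∞       _    = tt
    θ-InSubfield (fin x) σx≈x =
      [ (λ x≈0 → ≡.subst InSubfield (≡.sym (θ-zero x≈0)) tt)
      , (λ x≉0 → ≡.subst InSubfield (≡.sym (θ-fin x≉0))
          (sum-of-conjugates-fixed σx≈x (σ-⁻¹ x≉0 (trans (*-congʳ σx≈x) (⁻¹-inverseʳ x≉0))) refl)) ]′ (toSum (x ≟ 0#))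

    -- σ swaps `x` with its inverse and so fixes their sum.
    norm-one⇒θ-InSubfield : ∀ {x} → σ x * x ≈ 1# → InSubfield (θ F (fin x))
    norm-one⇒θ-InSubfield {x} σx*x≈1 = ≡.subst InSubfield (≡.sym (θ-fin x≉0))
      (sum-of-conjugates-fixed σx≈x⁻¹ (σ-⁻¹ x≉0 σx*x≈1) (+-comm _ x))
      where
      x≉0 = unit-nonzero (trans (*-comm x _) σx*x≈1)
      σx≈x⁻¹ : σ x ≈ x ⁻¹
      σx≈x⁻¹ = inverse-unique (trans (*-comm x _) σx*x≈1) (⁻¹-inverseʳ x≉0)

    θ^-InSubfield : ∀ P {k} → InSubfield (θ^ F k P) → ∀ {i} → k ℕ.≤′ i → InSubfield (θ^ F i P)
    θ^-InSubfield P inS ℕ.≤′-refl               = inS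
    θ^-InSubfield P inS (ℕ.≤′-step {i} k≤i) = θ-InSubfield (θ^ F i P) (θ^-InSubfield P inS k≤i)

    -- Where the orbit of γ stops being mixed.

    module _ {γ : Carrier} (γ≉1 : ¬ (γ ≈ 1#)) (σσγ*γ≈1 : σ (σ γ) * γ ≈ 1#) where

      private
        a : ℕ → Carrier
        a = orbit γ

        γ≉0 : ¬ (γ ≈ 0#)
        γ≉0 = unit-nonzero (trans (*-comm γ _) σσγ*γ≈1)

        MixedUpTo : ℕ → Set ℓ
        MixedUpTo = MixedOrbit γ

      ExitAt : ℕ → Set ℓ
      ExitAt i = σ (a i) * a i ≈ 1#

      -- Only the terms up to `p` have to be nonzero, so the agreement extends one index past the
      -- mixed run.
      θ^-orbit : ∀ {p} → MixedUpTo p → ∀ {i} → i ℕ.≤ suc p → θ^ F i (fin γ) ≡ fin (a i)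
      θ^-orbit mixed {ℕ.zero} _         = ≡.refl
      θ^-orbit mixed {suc i}  (ℕ.s≤s i≤p) = ≡.trans
        (≡.cong (θ F) (θ^-orbit mixed (ℕ.m≤n⇒m≤1+n i≤p))) (θ-fin (orbit-≉0 γ≉0 mixed i i≤p))

      private
        classify : ∀ i → σ (σ (a (suc i))) ≈ a (suc i) → ¬ (a i ≈ 0#) → ¬ (σ (a i) ≈ a i) → ¬ (ExitAt i) →
                   Mixed (a (suc i)) ⊎ ExitAt (suc i)
        classify i σσ≈ a≉0 σa≉a ¬exit with (σ (a (suc i)) * a (suc i)) ≟ 1#
        ... | yes exit  = inj₂ exit
        ... | no  ¬exit′ = inj₁ (σσ≈ , θ-unfixed a≉0 σa≉a ¬exit , ¬exit′)

        σσ-+ : ∀ {x x̄ y ȳ} → σ (σ x) ≈ y → σ (σ x̄) ≈ ȳ → σ (σ (x + x̄)) ≈ y + ȳ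
        σσ-+ σσx≈y σσx̄≈ȳ = trans (φ-cong n (φ-+ n _ _)) (trans (φ-+ n _ _) (+-cong σσx≈y σσx̄≈ȳ))

        σσ-⁻¹ : ∀ {x y} → ¬ (x ≈ 0#) → σ (σ x) * y ≈ 1# → σ (σ (x ⁻¹)) ≈ y
        σσ-⁻¹ x≉0 = inverse-unique (φ-inverse n (φ-inverse n (⁻¹-inverseʳ x≉0)))

      -- γ itself is not mixed: σ² inverts it, which still puts `θ γ` in the fixed field of σ². Were
      -- γ fixed or inverted by σ, then `σ (σ γ)` would be γ, giving `γ² = 1` and `γ = 1`.
      advance : ∀ i → MixedUpTo i → Mixed (a (suc i)) ⊎ ExitAt (suc i)
      advance ℕ.zero _ = classify 0 (trans (σσ-+ σσγ≈γ⁻¹ (σσ-⁻¹ γ≉0 σσγ*γ≈1)) (+-comm _ γ)) γ≉0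
        (λ σγ≈γ → γ≉1 (σ-trivial⇒1 σσγ*γ≈1 (trans (φ-cong n σγ≈γ) σγ≈γ)))
        (λ σγ*γ≈1 → γ≉1 (σ-trivial⇒1 σσγ*γ≈1 (inverse-unique
           (trans (*-comm _ _) (trans (sym (φ-* n (σ γ) γ)) (trans (φ-cong n σγ*γ≈1) (φ-1 n)))) σγ*γ≈1)))
        where
        σσγ≈γ⁻¹ : σ (σ γ) ≈ γ ⁻¹
        σσγ≈γ⁻¹ = inverse-unique (trans (*-comm γ _) σσγ*γ≈1) (⁻¹-inverseʳ γ≉0)
      advance (suc i) mixed =
        let (σσa≈a , σa≉a , ¬exit) = mixed (suc i) (ℕ.s≤s ℕ.z≤n) ℕ.≤-refl
            a≉0 = orbit-≉0 γ≉0 mixed (suc i) ℕ.≤-refl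
        in classify (suc i) (σσ-+ σσa≈a (σσ-⁻¹ a≉0 (trans (*-congʳ σσa≈a) (⁻¹-inverseʳ a≉0)))) a≉0 σa≉a ¬exit

      first-exit : ∀ i → MixedUpTo i ⊎ ∃ λ p → p ℕ.< i × MixedUpTo p × ExitAt (suc p)
      first-exit ℕ.zero = inj₁ λ j 1≤j j≤0 → contradiction (ℕ.≤-trans 1≤j j≤0) λ ()
      first-exit (suc i) with first-exit i
      ... | inj₂ (p , p<i , rest) = inj₂ (p , ℕ.m≤n⇒m≤1+n p<i , rest)
      ... | inj₁ mixed with advance i mixed
      ...   | inj₂ exit = inj₂ (i , ℕ.≤-refl , mixed , exit)
      ...   | inj₁ mixedᵢ₊₁ = inj₁ λ j 1≤j j≤1+i →
                [ (λ j<1+i → mixed j 1≤j (ℕ.≤-pred j<1+i)) , (λ where ≡.refl → mixedᵢ₊₁) ]′ (ℕ.m≤n⇒m<n∨m≡n j≤1+i)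

      exit⇒InSubfield : ∀ {p} → MixedUpTo p → ExitAt (suc p) → ∀ {i} → suc (suc p) ℕ.≤ i → InSubfield (θ^ F i (fin γ))
      exit⇒InSubfield {p} mixed exit p+2≤i = θ^-InSubfield (fin γ) {suc (suc p)}
        (≡.subst (InSubfield ∘ θ F) (≡.sym (θ^-orbit mixed ℕ.≤-refl)) (norm-one⇒θ-InSubfield exit)) (ℕ.≤⇒≤′ p+2≤i)

      exit⇒ord∣ : ∀ {p} → MixedUpTo p → ExitAt (suc p) → ord F (θ^ F (suc p) (fin γ)) ∣ q ℕ.+ 1
      exit⇒ord∣ mixed exit =
        ≡.subst (λ P → ord F P ∣ q ℕ.+ 1) (≡.sym (θ^-orbit mixed ℕ.≤-refl)) (norm-one⇒ord∣ exit)

      MixedUpTo⇒HasMixedOrder : ∀ {p} → MixedUpTo p → ∀ i → 1 ℕ.≤ i → i ℕ.≤ p → HasMixedOrder F q (θ^ F i (fin γ))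
      MixedUpTo⇒HasMixedOrder mixed i 1≤i i≤p =
        ≡.subst (HasMixedOrder F q) (≡.sym (θ^-orbit mixed (ℕ.m≤n⇒m≤1+n i≤p))) (Mixed⇒HasMixedOrder (mixed i 1≤i i≤p))

      module _ (l m : ℕ) (2∤m : 2 ∤ m) (n≡2^l*m : n ≡ 2 ℕ.^ l ℕ.* m) where

        exit-time : ∀ {p} → MixedUpTo p → ExitAt (suc p) → p ≡ 0 ⊎ p ≡ suc l
        exit-time {ℕ.zero} _     _    = inj₁ ≡.refl
        exit-time {suc p}  mixed exit =
          inj₂ (mixed-length l m 2∤m n≡2^l*m γ≉1 σσγ*γ≈1 (suc p) (ℕ.s≤s ℕ.z≤n) mixed exit)

        -- The only possible exits are at indices 1 and `l + 2`, and both are mixed here.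
        mixed-forever : MixedUpTo (suc (suc l)) → ∀ i → MixedUpTo i
        mixed-forever mixed i = [ (λ mixedᵢ → mixedᵢ) , (λ (p , _ , mixedₚ , exit) → contradiction exit (no-exit (exit-time mixedₚ exit))) ]′ (first-exit i)
          where
          no-exit : ∀ {p} → p ≡ 0 ⊎ p ≡ suc l → ¬ ExitAt (suc p)
          no-exit (inj₁ ≡.refl) = proj₂ (proj₂ (mixed 1 ℕ.≤-refl (ℕ.s≤s ℕ.z≤n)))
          no-exit (inj₂ ≡.refl) = proj₂ (proj₂ (mixed (suc (suc l)) (ℕ.s≤s ℕ.z≤n) ℕ.≤-refl))

        module _ {M : ℕ} (C : CyclicSubgroup F M) (γ∈H : H F C γ) where

          exit-at-1⇒H₁ : MixedUpTo 0 → ExitAt 1 → H₁ F C q γ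
          exit-at-1⇒H₁ mixed exit = γ∈H , exit⇒ord∣ mixed exit ,
            λ i 2≤i → InSubfield⇒ord∣ (θ^ F i (fin γ)) (exit⇒InSubfield mixed exit 2≤i)

          exit-at-l+2⇒H₂ : MixedUpTo (suc l) → ExitAt (suc (suc l)) → H₂ F C q l γ
          exit-at-l+2⇒H₂ mixed exit = γ∈H
            , (λ i 1≤i i≤l+1 → MixedUpTo⇒HasMixedOrder mixed i 1≤i (ℕ.≤-trans i≤l+1 (ℕ.≤-reflexive (ℕ.+-comm l 1))))
            , ≡.subst (λ i → ord F (θ^ F i (fin γ)) ∣ q ℕ.+ 1) (ℕ.+-comm 2 l) (exit⇒ord∣ mixed exit)
            , (λ i l+3≤i → InSubfield⇒ord∣ (θ^ F i (fin γ)) (exit⇒InSubfield mixed exit (ℕ.≤-trans (ℕ.≤-reflexive (ℕ.+-comm 3 l)) l+3≤i)))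

          no-exit⇒H₃ : MixedUpTo (suc (suc l)) → H₃ F C q γ
          no-exit⇒H₃ mixed = γ∈H , λ i 1≤i → MixedUpTo⇒HasMixedOrder (mixed-forever mixed i) i 1≤i ℕ.≤-refl

          partition : H₁ F C q γ ⊎ H₂ F C q l γ ⊎ H₃ F C q γ
          -- A search up to index `l + 2` covers every possible exit.
          partition = [ inj₂ ∘ inj₂ ∘ no-exit⇒H₃
                      , (λ (p , _ , mixed , exit) → exits mixed exit (exit-time mixed exit)) ]′ (first-exit (suc (suc l)))
            where
            exits : ∀ {p} → MixedUpTo p → ExitAt (suc p) → p ≡ 0 ⊎ p ≡ suc l → H₁ F C q γ ⊎ H₂ F C q l γ ⊎ H₃ F C q γ
            exits mixed exit (inj₁ ≡.refl) = inj₁ (exit-at-1⇒H₁ mixed exit)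
            exits mixed exit (inj₂ ≡.refl) = inj₂ (inj₁ (exit-at-l+2⇒H₂ mixed exit))

-- The partition of H and its disjointness.

open import Data.Nat.Base using (_+_; _*_; _^_; _<_)
open import Relation.Unary using (_≐_; _∪_; _∩_; Empty)

theorem4p3 : {c ℓ : Level} (l m n q : ℕ) → 0 < m → 2 ∤ m → n ≡ 2 ^ l * m → q ≡ 2 ^ n →
    (F : FiniteField c ℓ (q ^ 4)) (C : CyclicSubgroup F (q ^ 2 + 1)) →
    (H F C ≐ (H₁ F C q ∪ H₂ F C q l ∪ H₃ F C q))
    × Empty (H₁ F C q ∩ H₂ F C q l)
    × Empty (H₁ F C q ∩ H₃ F C q)
    × Empty (H₂ F C q l ∩ H₃ F C q)
theorem4p3 l m n q 0<m 2∤m n≡2^l*m ≡.refl F C =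
    ( (λ {γ} (γ∈C , γ≉1) → partition γ≉1 (σσγ*γ≈1 γ∈C) l m 2∤m n≡2^l*m C (γ∈C , γ≉1))
    , [ proj₁ , [ proj₁ , proj₁ ]′ ]′ )
  -- Disjointness is read off at one index, 1 for the pairs with H₁ and `l + 2` for H₂ and H₃: there
  -- one set gives an order dividing `q + 1` and the other a mixed order.
  , (λ γ ((_ , o∣q+1 , _) , (_ , mixed , _)) → HasMixedOrder⇒∤ 2∣q (θ F (fin γ)) (mixed 1 ℕ.≤-refl (ℕ.m≤n+m 1 l)) o∣q+1)
  , (λ γ ((_ , o∣q+1 , _) , (_ , mixed)) → HasMixedOrder⇒∤ 2∣q (θ F (fin γ)) (mixed 1 ℕ.≤-refl) o∣q+1)
  , (λ γ ((_ , _ , o∣q+1 , _) , (_ , mixed)) →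
      HasMixedOrder⇒∤ 2∣q (θ^ F (l + 2) (fin γ)) (mixed (l + 2) (ℕ.≤-trans (ℕ.n≤1+n 1) (ℕ.m≤n+m 2 l))) o∣q+1)
  where
  module 𝔽 = FiniteField F
  open FieldProperties F
  -- The field has `(2 ^ n) ^ 4 = 2 ^ (n * 4)` elements.
  open CharacteristicTwo F (characteristic-2 (n * 4) (ℕ.^-*-assoc 2 n 4))
  open Dynamics n
  2∣q : 2 ∣ 2 ^ n
  2∣q = ≡.subst (λ n → 2 ∣ 2 ^ n) (ℕ.suc-pred n {{ℕ.>-nonZero 0<n}}) (m∣m*n (2 ^ ℕ.pred n))
    where
    0<n : 0 < n
    0<n = ≡.subst (0 <_) (≡.sym n≡2^l*m) (ℕ.*-mono-≤ (ℕ.m^n>0 2 l) 0<m)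
  σσγ*γ≈1 : ∀ {γ} → CyclicSubgroup.Member C γ → σ (σ γ) 𝔽.* γ 𝔽.≈ 𝔽.1#
  σσγ*γ≈1 {γ} γ∈C = begin
    σ (σ γ) 𝔽.* γ              ≈⟨ 𝔽.*-cong (𝔽.trans (φ≈^ n (γ 𝔽.^ q)) (φ-cong n (φ≈^ n γ))) (𝔽.*-identityʳ γ) ⟨
    (γ 𝔽.^ q) 𝔽.^ q 𝔽.* γ 𝔽.^ 1  ≈⟨ 𝔽.*-congʳ (𝔽.trans (𝔽.^-assocʳ γ q q) (𝔽.^-congʳ γ (≡.cong (q *_) (≡.sym (ℕ.*-identityʳ q))))) ⟩
    γ 𝔽.^ (q ^ 2) 𝔽.* γ 𝔽.^ 1    ≈⟨ 𝔽.^-homo-* γ (q ^ 2) 1 ⟨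
    γ 𝔽.^ (q ^ 2 + 1)          ≈⟨ member^size C γ∈C ⟩
    𝔽.1#                       ∎
    where open import Relation.Binary.Reasoning.Setoid 𝔽.setoid
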